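{- Let $\mu\in\mathbb{M}$, $\alpha\in\mathbf{DIG}^{\omega}$, $r\in\mathbb{R}$, and let $p$ be a proof that $P_h(\mu,\alpha)$ holds. If $\mathsf{rep}(\alpha,r)$ holds, then $\mathsf{rep}(\bar h(\mu,\alpha,p),\mu(r))$ holds.
   Context: Möbius maps. $\mathbb{M}=\mathbb{Q}^4$ is the set of rational $2\times 2$ matrices $\mu=\left[\begin{smallmatrix}a&b\\c&d\end{smallmatrix}\right]$ (no nonsingularity required), acting by $\mu(x)=\frac{ax+b}{cx+d}$. $\mu$ is bounded if $cx+d\neq 0$ for all $x\in[-1,1]$. $\circ$ is the matrix product and $\phi^{ -1}$ the matrix inverse. Digits. $\mathbf{DIG}=\{\mathbf L,\mathbf R,\mathbf M\}$, interpreted as the matrices $\mathbf L=\left[\begin{smallmatrix}1/2&-1/2\\1/2&3/2\end{smallmatrix}\right]$, $\mathbf R=\left[\begin{smallmatrix}1/2&1/2\\-1/2&3/2\end{smallmatrix}\right]$, $\mathbf M=\left[\begin{smallmatrix}1&0\\0&3\end{smallmatrix}\right]$. $\mathbf{DIG}^{\omega}$ is the (coinductive) type of infinite streams over $\mathbf{DIG}$, with constructor $\mathsf{Cons}$, head $\mathsf{hd}$ and tail $\mathsf{tl}$; $\cong$ is bisimilarity (equality of all entries) of streams. For $\mu\in\mathbb{M}$, $\phi\in\mathbf{DIG}$, the decidable emission condition $\mathbf{Incl}(\mu,\phi)$ means: $\mu$ is bounded and $\mu([-1,1])\subseteq\phi([-1,1])$. Homographic algorithm. $E_h(\mu,\alpha)$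 is the inductively defined (least) predicate with rules: if $\mathbf{Incl}(\mu,\phi)$ for some $\phi\in\mathbf{DIG}$ then $E_h(\mu,\alpha)$ (one rule for each of $\mathbf L,\mathbf R,\mathbf M$); if $E_h(\mu\circ\mathsf{hd}(\alpha),\mathsf{tl}(\alpha))$ then $E_h(\mu,\alpha)$. For a proof $t$ of $E_h(\mu,\alpha)$, the triple $\overline m_h(\mu,\alpha,t)\in\mathbf{DIG}\times\mathbb{M}\times\mathbf{DIG}^{\omega}$ is defined by structural recursion on $t$: it is $(\mathbf L,\mathbf L^{ -1}\circ\mu,\alpha)$ if $\mathbf{Incl}(\mu,\mathbf L)$; else $(\mathbf R,\mathbf R^{ -1}\circ\mu,\alpha)$ if $\mathbf{Incl}(\mu,\mathbf R)$; else $(\mathbf M,\mathbf M^{ -1}\circ\mu,\alpha)$ if $\mathbf{Incl}(\mu,\mathbf M)$; otherwise $\overline m_h(\mu\circ\mathsf{hd}(\alpha),\mathsf{tl}(\alpha),t')$, where $t'$ is the proof of $E_h(\mu\circ\mathsf{hd}(\alpha),\mathsf{tl}(\alpha))$ obtained from $t$ by inversion. $\pi_1,\pi_2,\pi_3$ are the projections of a triple. $\Psi_h(n,\mu,\alpha)$ ($n\in\mathbb{N}$) is the inductive predicate with rules: $E_h(\mu,\alpha)$ implies $\Psi_h(0,\mu,\alpha)$; for a proof $t$ of $E_h(\mu,\alpha)$, $\Psi_h(n,\pi_2(\overline m_h(\mu,\alpha,t)),\pi_3(\overline m_h(\mu,\alpha,t)))$ implies $\Psi_h(n+1,\mu,\alpha)$.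 The productivity predicate is $P_h(\mu,\alpha):\Leftrightarrow\forall n\in\mathbb{N},\ \Psi_h(n+1,\mu,\alpha)$. $P_h(\mu,\alpha)$ implies $E_h(\mu,\alpha)$, and it implies $P_h(\pi_2(\overline m_h(\mu,\alpha,t)),\pi_3(\overline m_h(\mu,\alpha,t)))$ for any proof $t$ of $E_h(\mu,\alpha)$. For a proof $p$ of $P_h(\mu,\alpha)$, with $t$ the induced proof of $E_h(\mu,\alpha)$ and $\overline m_h(\mu,\alpha,t)=(\phi,\mu',\alpha')$ and $p'$ the induced proof of $P_h(\mu',\alpha')$, the stream $\bar h(\mu,\alpha,p)\in\mathbf{DIG}^{\omega}$ is defined corecursively by $\bar h(\mu,\alpha,p)=\mathsf{Cons}\ \phi\ \bar h(\mu',\alpha',p')$. Representation. $\mathsf{rep}\subseteq\mathbf{DIG}^{\omega}\times\mathbb{R}$ is the coinductively defined (greatest) relation generated by the three rules: whenever $-1\le r\le 1$ and $\mathsf{rep}(\alpha,r)$, then $\mathsf{rep}(\beta,\frac{r-1}{r+3})$ if $\beta\cong\mathsf{Cons}\ \mathbf L\ \alpha$; $\mathsf{rep}(\beta,\frac{r+1}{ -r+3})$ if $\beta\cong\mathsf{Cons}\ \mathbf R\ \alpha$; $\mathsf{rep}(\beta,\frac r3)$ if $\beta\cong\mathsf{Cons}\ \mathbf M\ \alpha$. (That is, the greatest relation such that every related pair arises as the conclusion of one of these rules from a related pair.) -}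

module Defs where

open import Algebra.Bundles using (CommutativeRing)
open import Data.Integer.Base as ℤ using (+_)
open import Data.Nat.Base as ℕ using (ℕ; zero; suc)
import Data.Nat.Properties as ℕ
open import Data.Product.Base using (Σ-syntax; ∃; ∃-syntax; _×_; _,_; proj₁; proj₂)
open import Data.Rational.Base as ℚ using (ℚ; 0ℚ; 1ℚ; ½; -½; ∣_∣)
import Data.Rational.Properties as ℚ
open import Data.Rational.Solver using (module +-*-Solver)
open import Data.Sum.Base using (_⊎_; inj₁; inj₂; [_,_]′)
open import Level using (0ℓ)
open import Relation.Binary.Core using (Rel)
open import Relation.Binary.PropositionalEquality
  using (_≡_; _≢_; refl; sym; trans; cong; cong₂; subst; subst₂)
import Relation.Binary.Reasoning.Setoid as SetoidReasoning
open import Relation.Nullary.Decidable using (Dec; yes; no; _×-dec_; toWitness)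
open import Relation.Nullary.Negation using (¬_; contradiction)

module ℚ-Arithmetic where
  open +-*-Solver

  <-by₁ : ∀ {u v a b} → a ℚ.< b → u ℚ.+ b ≡ v ℚ.+ a → u ℚ.< v
  <-by₁ {u} {v} {a} {b} a<b e = subst₂ ℚ._<_ (cancel u b) (cancel v b)
    (ℚ.+-monoˡ-< (ℚ.- b) (subst (ℚ._< v ℚ.+ b) (sym e) (ℚ.+-monoʳ-< v a<b)))
    where
    cancel : ∀ p q → (p ℚ.+ q) ℚ.+ (ℚ.- q) ≡ p
    cancel = solve 2 (λ p q → (p :+ q) :+ (:- q) := p) refl

  ≤-by₁ : ∀ {u v a b} → a ℚ.≤ b → u ℚ.+ b ≡ v ℚ.+ a → u ℚ.≤ v
  ≤-by₁ {u} {v} {a} {b} a≤b e = subst₂ ℚ._≤_ (cancel u b) (cancel v b)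
    (ℚ.+-monoˡ-≤ (ℚ.- b) (subst (ℚ._≤ v ℚ.+ b) (sym e) (ℚ.+-monoʳ-≤ v a≤b)))
    where
    cancel : ∀ p q → (p ℚ.+ q) ℚ.+ (ℚ.- q) ≡ p
    cancel = solve 2 (λ p q → (p :+ q) :+ (:- q) := p) refl

  *-pos : ∀ {p q} → 0ℚ ℚ.< p → 0ℚ ℚ.< q → 0ℚ ℚ.< p ℚ.* q
  *-pos {p} {q} 0<p 0<q = subst (ℚ._< p ℚ.* q) (ℚ.*-zeroʳ p)
    (ℚ.*-monoʳ-<-pos p {{ℚ.positive 0<p}} 0<q)

  *-nonNeg : ∀ {p q} → 0ℚ ℚ.≤ p → 0ℚ ℚ.≤ q → 0ℚ ℚ.≤ p ℚ.* q
  *-nonNeg {p} {q} 0≤p 0≤q = subst (ℚ._≤ p ℚ.* q) (ℚ.*-zeroʳ p)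
    (ℚ.*-monoˡ-≤-nonNeg p {{ℚ.nonNegative 0≤p}} 0≤q)

  *-mono-≤ : ∀ {p q r s} → 0ℚ ℚ.≤ r → 0ℚ ℚ.≤ q →
             p ℚ.≤ q → r ℚ.≤ s → p ℚ.* r ℚ.≤ q ℚ.* s
  *-mono-≤ {p} {q} {r} {s} 0≤r 0≤q p≤q r≤s = ℚ.≤-trans
    (ℚ.*-monoʳ-≤-nonNeg r {{ℚ.nonNegative 0≤r}} p≤q)
    (ℚ.*-monoˡ-≤-nonNeg q {{ℚ.nonNegative 0≤q}} r≤s)

  p≤∣p∣ : ∀ p → p ℚ.≤ ∣ p ∣
  p≤∣p∣ p with ℚ.≤-total 0ℚ p
  ... | inj₁ 0≤p = ℚ.≤-reflexive (sym (ℚ.0≤p⇒∣p∣≡p 0≤p))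
  ... | inj₂ p≤0 = ℚ.≤-trans p≤0 (ℚ.0≤∣p∣ p)

  ∣p-q∣≡∣q-p∣ : ∀ p q → ∣ p ℚ.- q ∣ ≡ ∣ q ℚ.- p ∣
  ∣p-q∣≡∣q-p∣ p q = trans (sym (ℚ.∣-p∣≡∣p∣ (p ℚ.- q)))
    (cong ∣_∣ (solve 2 (λ p q → :- (p :- q) := q :- p) refl p q))

  ∣∣< : ∀ {p r} → p ℚ.< r → ℚ.- p ℚ.< r → ∣ p ∣ ℚ.< r
  ∣∣< {p} p<r -p<r with ℚ.∣p∣≡p∨∣p∣≡-p p
  ... | inj₁ e = subst (ℚ._< _) (sym e) p<r
  ... | inj₂ e = subst (ℚ._< _) (sym e) -p<r

  0<½ : 0ℚ ℚ.< ½
  0<½ = ℚ.positive⁻¹ ½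

  0<1 : 0ℚ ℚ.< 1ℚ
  0<1 = ℚ.positive⁻¹ 1ℚ

  halve : ∀ {ε} → 0ℚ ℚ.< ε → 0ℚ ℚ.< ½ ℚ.* ε
  halve = *-pos 0<½

  halves : ∀ ε → ½ ℚ.* ε ℚ.+ ½ ℚ.* ε ≡ ε
  halves = solve 1 (λ ε → con ½ :* ε :+ con ½ :* ε := ε) refl

  -- The total reciprocal with 1/0 = 0.
  recip : ℚ → ℚ
  recip q with q ℚ.≟ 0ℚ
  ... | yes _  = 0ℚ
  ... | no q≢0 = ℚ.1/_ q {{ℚ.≢-nonZero q≢0}}

  *-recip : ∀ {q} → q ≢ 0ℚ → q ℚ.* recip q ≡ 1ℚ
  *-recip {q} q≢0 with q ℚ.≟ 0ℚ
  ... | yes q≡0  = contradiction q≡0 q≢0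
  ... | no  q≢0′ = ℚ.*-inverseʳ q {{ℚ.≢-nonZero q≢0′}}

  recip-pos : ∀ {q} → 0ℚ ℚ.< q → 0ℚ ℚ.< recip q
  recip-pos {q} 0<q with q ℚ.≟ 0ℚ
  ... | yes q≡0 = contradiction (sym q≡0) (ℚ.<⇒≢ 0<q)
  ... | no  q≢0 =
    ℚ.positive⁻¹ _ {{ℚ.1/pos⇒pos q {{ℚ.positive 0<q}}}}

  *-estimate : ∀ {B ε} a b a′ b′ → 0ℚ ℚ.< B → ∣ a ∣ ℚ.≤ B → ∣ b′ ∣ ℚ.≤ B →
               ∣ a ℚ.- a′ ∣ ℚ.< ε ℚ.* recip (B ℚ.+ B) → ∣ b ℚ.- b′ ∣ ℚ.< ε ℚ.* recip (B ℚ.+ B) →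
               ∣ a ℚ.* b ℚ.- a′ ℚ.* b′ ∣ ℚ.< ε
  *-estimate {B} {ε} a b a′ b′ 0<B ∣a∣≤B ∣b′∣≤B da db = begin-strict
    ∣ a ℚ.* b ℚ.- a′ ℚ.* b′ ∣                          ≡⟨ cong ∣_∣ (split a b a′ b′) ⟩
    ∣ a ℚ.* (b ℚ.- b′) ℚ.+ (a ℚ.- a′) ℚ.* b′ ∣         ≤⟨ ℚ.∣p+q∣≤∣p∣+∣q∣ (a ℚ.* (b ℚ.- b′)) ((a ℚ.- a′) ℚ.* b′) ⟩
    ∣ a ℚ.* (b ℚ.- b′) ∣ ℚ.+ ∣ (a ℚ.- a′) ℚ.* b′ ∣
      ≡⟨ cong₂ ℚ._+_ (ℚ.∣p*q∣≡∣p∣*∣q∣ a (b ℚ.- b′)) (ℚ.∣p*q∣≡∣p∣*∣q∣ (a ℚ.- a′) b′) ⟩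
    ∣ a ∣ ℚ.* ∣ b ℚ.- b′ ∣ ℚ.+ ∣ a ℚ.- a′ ∣ ℚ.* ∣ b′ ∣
      ≤⟨ ℚ.+-mono-≤ (*-mono-≤ (ℚ.0≤∣p∣ (b ℚ.- b′)) (ℚ.<⇒≤ 0<B) ∣a∣≤B ℚ.≤-refl)
                    (*-mono-≤ (ℚ.0≤∣p∣ b′) (ℚ.0≤∣p∣ (a ℚ.- a′)) ℚ.≤-refl ∣b′∣≤B) ⟩
    B ℚ.* ∣ b ℚ.- b′ ∣ ℚ.+ ∣ a ℚ.- a′ ∣ ℚ.* B
      <⟨ ℚ.+-mono-< (ℚ.*-monoʳ-<-pos B {{ℚ.positive 0<B}} db) (ℚ.*-monoˡ-<-pos B {{ℚ.positive 0<B}} da) ⟩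
    B ℚ.* (ε ℚ.* recip (B ℚ.+ B)) ℚ.+ (ε ℚ.* recip (B ℚ.+ B)) ℚ.* B
      ≡⟨ collect B ε (recip (B ℚ.+ B)) ⟩
    ε ℚ.* ((B ℚ.+ B) ℚ.* recip (B ℚ.+ B))
      ≡⟨ cong (ε ℚ.*_) (*-recip (λ e → ℚ.<⇒≢ (ℚ.+-mono-< 0<B 0<B) (sym e))) ⟩
    ε ℚ.* 1ℚ                                             ≡⟨ ℚ.*-identityʳ ε ⟩
    ε ∎
    where
    open ℚ.≤-Reasoning
    split : ∀ a b a′ b′ → a ℚ.* b ℚ.- a′ ℚ.* b′ ≡ a ℚ.* (b ℚ.- b′) ℚ.+ (a ℚ.- a′) ℚ.* b′
    split = solve 4 (λ a b a′ b′ → a :* b :- a′ :* b′ := a :* (b :- b′) :+ (a :- a′) :* b′) refl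
    collect : ∀ B ε r → B ℚ.* (ε ℚ.* r) ℚ.+ (ε ℚ.* r) ℚ.* B ≡ ε ℚ.* ((B ℚ.+ B) ℚ.* r)
    collect = solve 3 (λ B ε r → B :* (ε :* r) :+ (ε :* r) :* B := ε :* ((B :+ B) :* r)) refl

  ∣∣-apart : ∀ {δ} a → 0ℚ ℚ.< δ → δ ℚ.≤ ∣ a ∣ → a ≢ 0ℚ
  ∣∣-apart _ 0<δ δ≤∣a∣ refl = ℚ.<-irrefl refl (ℚ.<-≤-trans 0<δ δ≤∣a∣)

  ∣recip∣*δ≤1 : ∀ {δ} a → 0ℚ ℚ.< δ → δ ℚ.≤ ∣ a ∣ → ∣ recip a ∣ ℚ.* δ ℚ.≤ 1ℚ
  ∣recip∣*δ≤1 {δ} a 0<δ δ≤∣a∣ = begin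
    ∣ recip a ∣ ℚ.* δ      ≤⟨ *-mono-≤ (ℚ.<⇒≤ 0<δ) (ℚ.0≤∣p∣ (recip a)) ℚ.≤-refl δ≤∣a∣ ⟩
    ∣ recip a ∣ ℚ.* ∣ a ∣  ≡⟨ ℚ.*-comm (∣ recip a ∣) (∣ a ∣) ⟩
    ∣ a ∣ ℚ.* ∣ recip a ∣  ≡⟨ sym (ℚ.∣p*q∣≡∣p∣*∣q∣ a (recip a)) ⟩
    ∣ a ℚ.* recip a ∣      ≡⟨ cong ∣_∣ (*-recip (∣∣-apart a 0<δ δ≤∣a∣)) ⟩
    1ℚ ∎
    where open ℚ.≤-Reasoning

  recip-estimate : ∀ {δ ε} a b → 0ℚ ℚ.< δ → δ ℚ.≤ ∣ a ∣ → δ ℚ.≤ ∣ b ∣ →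
                   ∣ a ℚ.- b ∣ ℚ.< ε ℚ.* (δ ℚ.* δ) → ∣ recip a ℚ.- recip b ∣ ℚ.< ε
  recip-estimate {δ} {ε} a b 0<δ δ≤∣a∣ δ≤∣b∣ d =
    ℚ.*-cancelʳ-<-nonNeg (δ ℚ.* δ) {{ℚ.nonNegative (ℚ.<⇒≤ (*-pos 0<δ 0<δ))}} (begin-strict
      ∣ ra ℚ.- rb ∣ ℚ.* (δ ℚ.* δ)  ≡⟨ cong (λ z → ∣ z ∣ ℚ.* (δ ℚ.* δ)) diff ⟩
      ∣ (b ℚ.- a) ℚ.* (ra ℚ.* rb) ∣ ℚ.* (δ ℚ.* δ)
        ≡⟨ cong (ℚ._* (δ ℚ.* δ)) (trans (ℚ.∣p*q∣≡∣p∣*∣q∣ (b ℚ.- a) (ra ℚ.* rb))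
             (cong₂ ℚ._*_ (∣p-q∣≡∣q-p∣ b a) (ℚ.∣p*q∣≡∣p∣*∣q∣ ra rb))) ⟩
      ∣ a ℚ.- b ∣ ℚ.* (∣ ra ∣ ℚ.* ∣ rb ∣) ℚ.* (δ ℚ.* δ)
        ≡⟨ regroup (∣ a ℚ.- b ∣) (∣ ra ∣) (∣ rb ∣) δ ⟩
      ∣ a ℚ.- b ∣ ℚ.* ((∣ ra ∣ ℚ.* δ) ℚ.* (∣ rb ∣ ℚ.* δ))
        ≤⟨ *-mono-≤ (*-nonNeg (*-nonNeg (ℚ.0≤∣p∣ ra) 0≤δ) (*-nonNeg (ℚ.0≤∣p∣ rb) 0≤δ))
             (ℚ.0≤∣p∣ (a ℚ.- b)) ℚ.≤-refl
             (*-mono-≤ (*-nonNeg (ℚ.0≤∣p∣ rb) 0≤δ) (ℚ.<⇒≤ 0<1)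
                (∣recip∣*δ≤1 a 0<δ δ≤∣a∣) (∣recip∣*δ≤1 b 0<δ δ≤∣b∣)) ⟩
      ∣ a ℚ.- b ∣ ℚ.* (1ℚ ℚ.* 1ℚ)  ≡⟨ ℚ.*-identityʳ (∣ a ℚ.- b ∣) ⟩
      ∣ a ℚ.- b ∣                    <⟨ d ⟩
      ε ℚ.* (δ ℚ.* δ) ∎)
    where
    open ℚ.≤-Reasoning
    ra = recip a
    rb = recip b
    0≤δ = ℚ.<⇒≤ 0<δ
    diff : ra ℚ.- rb ≡ (b ℚ.- a) ℚ.* (ra ℚ.* rb)
    diff = sym (trans (solve 4 (λ a b r s → (b :- a) :* (r :* s) := (b :* s) :* r :- (a :* r) :* s) refl a b ra rb)
      (trans (cong₂ (λ p q → p ℚ.* ra ℚ.- q ℚ.* rb)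
               (*-recip (∣∣-apart b 0<δ δ≤∣b∣)) (*-recip (∣∣-apart a 0<δ δ≤∣a∣)))
             (cong₂ ℚ._-_ (ℚ.*-identityˡ ra) (ℚ.*-identityˡ rb))))
    regroup : ∀ x p q δ → x ℚ.* (p ℚ.* q) ℚ.* (δ ℚ.* δ) ≡ x ℚ.* ((p ℚ.* δ) ℚ.* (q ℚ.* δ))
    regroup = solve 4 (λ x p q δ → x :* (p :* q) :* (δ :* δ) := x :* ((p :* δ) :* (q :* δ))) refl

  ∣p-p∣< : ∀ {ε} p q → p ≡ q → 0ℚ ℚ.< ε → ∣ p ℚ.- q ∣ ℚ.< ε
  ∣p-p∣< {ε} p _ refl 0<ε = subst (ℚ._< ε) (sym (cong ∣_∣ (ℚ.+-inverseʳ p))) 0<ε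

  +-estimate : ∀ {ε} a b a′ b′ → ∣ a ℚ.- a′ ∣ ℚ.< ½ ℚ.* ε → ∣ b ℚ.- b′ ∣ ℚ.< ½ ℚ.* ε →
               ∣ (a ℚ.+ b) ℚ.- (a′ ℚ.+ b′) ∣ ℚ.< ε
  +-estimate {ε} a b a′ b′ da db = begin-strict
    ∣ (a ℚ.+ b) ℚ.- (a′ ℚ.+ b′) ∣     ≡⟨ cong ∣_∣ (regroup a b a′ b′) ⟩
    ∣ (a ℚ.- a′) ℚ.+ (b ℚ.- b′) ∣     ≤⟨ ℚ.∣p+q∣≤∣p∣+∣q∣ (a ℚ.- a′) (b ℚ.- b′) ⟩
    ∣ a ℚ.- a′ ∣ ℚ.+ ∣ b ℚ.- b′ ∣     <⟨ ℚ.+-mono-< da db ⟩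
    ½ ℚ.* ε ℚ.+ ½ ℚ.* ε               ≡⟨ halves ε ⟩
    ε ∎
    where
    open ℚ.≤-Reasoning
    regroup : ∀ a b a′ b′ → (a ℚ.+ b) ℚ.- (a′ ℚ.+ b′) ≡ (a ℚ.- a′) ℚ.+ (b ℚ.- b′)
    regroup = solve 4 (λ a b a′ b′ → (a :+ b) :- (a′ :+ b′) := (a :- a′) :+ (b :- b′)) refl

  neg-estimate : ∀ {ε} a a′ → ∣ a ℚ.- a′ ∣ ℚ.< ε → ∣ ℚ.- a ℚ.- (ℚ.- a′) ∣ ℚ.< ε
  neg-estimate {ε} a a′ = subst (ℚ._< ε) (trans (∣p-q∣≡∣q-p∣ a a′)
    (cong ∣_∣ (solve 2 (λ a a′ → a′ :- a := (:- a) :- (:- a′)) refl a a′)))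

  nonPos-estimate : ∀ {B ε} a b → 0ℚ ℚ.< B → a ℚ.≤ 0ℚ → ∣ b ∣ ℚ.≤ B →
                    0ℚ ℚ.< a ℚ.+ ε ℚ.* recip B → 0ℚ ℚ.< a ℚ.* b ℚ.+ ε
  nonPos-estimate {B} {ε} a b 0<B a≤0 ∣b∣≤B a> =
    <-by₁ lt (solve 3 (λ a b ε → con 0ℚ :+ ε := (a :* b :+ ε) :+ (:- (a :* b))) refl a b ε)
    where
    open ℚ.≤-Reasoning
    lt : ℚ.- (a ℚ.* b) ℚ.< ε
    lt = begin-strict
      ℚ.- (a ℚ.* b)             ≤⟨ p≤∣p∣ (ℚ.- (a ℚ.* b)) ⟩
      ∣ ℚ.- (a ℚ.* b) ∣         ≡⟨ trans (ℚ.∣-p∣≡∣p∣ (a ℚ.* b)) (ℚ.∣p*q∣≡∣p∣*∣q∣ a b) ⟩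
      ∣ a ∣ ℚ.* ∣ b ∣           ≤⟨ *-mono-≤ (ℚ.0≤∣p∣ b) (ℚ.0≤∣p∣ a) ℚ.≤-refl ∣b∣≤B ⟩
      ∣ a ∣ ℚ.* B               ≡⟨ cong (ℚ._* B) (trans (sym (ℚ.∣-p∣≡∣p∣ a)) (ℚ.0≤p⇒∣p∣≡p (ℚ.neg-antimono-≤ a≤0))) ⟩
      (ℚ.- a) ℚ.* B             <⟨ ℚ.*-monoˡ-<-pos B {{ℚ.positive 0<B}}
                                     (<-by₁ {ℚ.- a} {ε ℚ.* recip B} a> (solve 2 (λ a r → (:- a) :+ (a :+ r) := r :+ con 0ℚ) refl a (ε ℚ.* recip B))) ⟩
      (ε ℚ.* recip B) ℚ.* B     ≡⟨ solve 3 (λ ε r B → (ε :* r) :* B := ε :* (B :* r)) refl ε (recip B) B ⟩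
      ε ℚ.* (B ℚ.* recip B)     ≡⟨ cong (ε ℚ.*_) (*-recip (λ e → ℚ.<⇒≢ 0<B (sym e))) ⟩
      ε ℚ.* 1ℚ                  ≡⟨ ℚ.*-identityʳ ε ⟩
      ε ∎

  nonNeg-estimate : ∀ {B ε} a b → 0ℚ ℚ.< B → 0ℚ ℚ.< ε → ∣ a ∣ ℚ.≤ B → ∣ b ∣ ℚ.≤ B →
                    0ℚ ℚ.< a ℚ.+ ε ℚ.* recip B → 0ℚ ℚ.< b ℚ.+ ε ℚ.* recip B →
                    0ℚ ℚ.< a ℚ.* b ℚ.+ ε
  nonNeg-estimate {B} {ε} a b 0<B 0<ε ∣a∣≤B ∣b∣≤B a> b>
    with ℚ.≤-total 0ℚ a | ℚ.≤-total 0ℚ b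
  ... | inj₁ 0≤a | inj₁ 0≤b = ℚ.+-mono-≤-< (*-nonNeg 0≤a 0≤b) 0<ε
  ... | inj₂ a≤0 | _        = nonPos-estimate a b 0<B a≤0 ∣b∣≤B a>
  ... | inj₁ _   | inj₂ b≤0 = subst (λ z → 0ℚ ℚ.< z ℚ.+ ε) (ℚ.*-comm b a) (nonPos-estimate b a 0<B b≤0 ∣a∣≤B b>)

  recip-antimono : ∀ {p q} → 0ℚ ℚ.< p → p ℚ.≤ q → recip q ℚ.≤ recip p
  recip-antimono {p} {q} 0<p p≤q = begin
    recip q                           ≡⟨ ℚ.*-identityʳ (recip q) ⟨
    recip q ℚ.* 1ℚ                    ≡⟨ cong (recip q ℚ.*_) (*-recip (λ e → ℚ.<⇒≢ 0<p (sym e))) ⟨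
    recip q ℚ.* (p ℚ.* recip p)       ≤⟨ *-mono-≤ (*-nonNeg (ℚ.<⇒≤ 0<p) (ℚ.<⇒≤ (recip-pos 0<p))) (ℚ.<⇒≤ (recip-pos 0<q)) ℚ.≤-refl
                                           (*-mono-≤ (ℚ.<⇒≤ (recip-pos 0<p)) (ℚ.<⇒≤ 0<q) p≤q ℚ.≤-refl) ⟩
    recip q ℚ.* (q ℚ.* recip p)       ≡⟨ solve 3 (λ q r s → s :* (q :* r) := (q :* s) :* r) refl q (recip p) (recip q) ⟩
    (q ℚ.* recip q) ℚ.* recip p       ≡⟨ cong (ℚ._* recip p) (*-recip (λ e → ℚ.<⇒≢ 0<q (sym e))) ⟩
    1ℚ ℚ.* recip p                    ≡⟨ ℚ.*-identityˡ (recip p) ⟩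
    recip p                           ∎
    where
    open ℚ.≤-Reasoning
    0<q = ℚ.<-≤-trans 0<p p≤q

open ℚ-Arithmetic

Eventually : (ℕ → Set) → Set
Eventually P = ∃[ N ] ∀ n → N ℕ.≤ n → P n

private
  variable
    P Q U V W : ℕ → Set

always : (∀ n → P n) → Eventually P
always f = 0 , λ n _ → f n

eventually₁ : (∀ n → P n → Q n) → Eventually P → Eventually Q
eventually₁ f (N , p) = N , λ n N≤n → f n (p n N≤n)

eventually₂ : (∀ n → P n → Q n → U n) → Eventually P → Eventually Q → Eventually U
eventually₂ f (M , p) (N , q) = M ℕ.⊔ N , λ n le →
  f n (p n (ℕ.m⊔n≤o⇒m≤o M N le)) (q n (ℕ.m⊔n≤o⇒n≤o M N le))

eventually₄ : (∀ n → P n → Q n → U n → V n → W n) →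
              Eventually P → Eventually Q → Eventually U → Eventually V → Eventually W
eventually₄ f p q r s = eventually₂ (λ n (pn , qn) (rn , sn) → f n pn qn rn sn)
  (eventually₂ (λ _ → _,_) p q) (eventually₂ (λ _ → _,_) r s)

now : Eventually P → ∃ P
now (N , p) = N , p N ℕ.≤-refl

-- Real numbers: Cauchy sequences of rationals with an explicit modulus,
-- identified by the equivalence _≈_

record ℝ : Set where
  no-eta-equality
  field
    seq    : ℕ → ℚ
    cauchy : ∀ ε → 0ℚ ℚ.< ε →
             ∃[ N ] ∀ m n → N ℕ.≤ m → N ℕ.≤ n → ∣ seq m ℚ.- seq n ∣ ℚ.< ε

open ℝ public

infix 4 _≈_ _≤_ _<_ _#_

record _≈_ (x y : ℝ) : Set where
  constructor mk≈
  field close : ∀ ε → 0ℚ ℚ.< ε → Eventually λ n → ∣ seq x n ℚ.- seq y n ∣ ℚ.< ε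

record _≤_ (x y : ℝ) : Set where
  constructor mk≤
  field below : ∀ ε → 0ℚ ℚ.< ε → Eventually λ n → seq x n ℚ.< seq y n ℚ.+ ε

record _<_ (x y : ℝ) : Set where
  constructor mk<
  field gap : ∃[ ε ] 0ℚ ℚ.< ε × Eventually λ n → seq x n ℚ.+ ε ℚ.≤ seq y n

-- The constructive form of x ≠ y.
_#_ : Rel ℝ 0ℓ
x # y = x < y ⊎ y < x

bounded : ∀ x → ∃[ B ] 0ℚ ℚ.< B × Eventually λ n → ∣ seq x n ∣ ℚ.≤ B
bounded x = let (N , c) = cauchy x 1ℚ 0<1 in
  ∣ seq x N ∣ ℚ.+ 1ℚ ,
  ℚ.+-mono-≤-< (ℚ.0≤∣p∣ (seq x N)) 0<1 ,
  N , λ n N≤n → begin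
    ∣ seq x n ∣                                   ≡⟨ cong ∣_∣ (split (seq x n) (seq x N)) ⟩
    ∣ seq x N ℚ.+ (seq x n ℚ.- seq x N) ∣         ≤⟨ ℚ.∣p+q∣≤∣p∣+∣q∣ (seq x N) _ ⟩
    ∣ seq x N ∣ ℚ.+ ∣ seq x n ℚ.- seq x N ∣       ≤⟨ ℚ.+-monoʳ-≤ (∣ seq x N ∣) (ℚ.<⇒≤ (c n N N≤n ℕ.≤-refl)) ⟩
    ∣ seq x N ∣ ℚ.+ 1ℚ                            ∎
  where
  open ℚ.≤-Reasoning
  open +-*-Solver
  split : ∀ p q → p ≡ q ℚ.+ (p ℚ.- q)
  split = solve 2 (λ p q → p := q :+ (p :- q)) refl

bounded₂ : ∀ x y → ∃[ B ] 0ℚ ℚ.< B ×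
           Eventually (λ n → ∣ seq x n ∣ ℚ.≤ B) × Eventually (λ n → ∣ seq y n ∣ ℚ.≤ B)
bounded₂ x y =
  let (B , 0<B , b) = bounded x
      (C , 0<C , c) = bounded y
  in B ℚ.+ C , ℚ.+-mono-< 0<B 0<C ,
     eventually₁ (λ n le → ℚ.≤-trans le (≤-by₁ (ℚ.<⇒≤ 0<C) (sym (ℚ.+-identityʳ (B ℚ.+ C))))) b ,
     eventually₁ (λ n le → ℚ.≤-trans le (≤-by₁ (ℚ.<⇒≤ 0<B)
       (trans (ℚ.+-comm C B) (sym (ℚ.+-identityʳ (B ℚ.+ C)))))) c

infixl 6 _+_ _-_
infixl 7 _*_
infix  8 -_

ι : ℚ → ℝ
seq    (ι q) _       = q
cauchy (ι q) ε 0<ε = 0 , λ _ _ _ _ → ∣p-p∣< q q refl 0<ε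

0ℝ 1ℝ 3ℝ : ℝ
0ℝ = ι 0ℚ
1ℝ = ι 1ℚ
3ℝ = ι (+ 3 ℚ./ 1)

_+_ : ℝ → ℝ → ℝ
seq    (x + y) n = seq x n ℚ.+ seq y n
cauchy (x + y) ε 0<ε =
  let (M , p) = cauchy x (½ ℚ.* ε) (halve 0<ε)
      (N , q) = cauchy y (½ ℚ.* ε) (halve 0<ε)
  in M ℕ.⊔ N , λ m n hm hn → +-estimate (seq x m) (seq y m) (seq x n) (seq y n)
       (p m n (ℕ.m⊔n≤o⇒m≤o M N hm) (ℕ.m⊔n≤o⇒m≤o M N hn))
       (q m n (ℕ.m⊔n≤o⇒n≤o M N hm) (ℕ.m⊔n≤o⇒n≤o M N hn))

-_ : ℝ → ℝ
seq    (- x) n       = ℚ.- seq x n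
cauchy (- x) ε 0<ε =
  let (N , p) = cauchy x ε 0<ε
  in N , λ m n hm hn → neg-estimate (seq x m) (seq x n) (p m n hm hn)

_-_ : ℝ → ℝ → ℝ
x - y = x + (- y)

_*_ : ℝ → ℝ → ℝ
seq    (x * y) n = seq x n ℚ.* seq y n
cauchy (x * y) ε 0<ε =
  let (B , 0<B , (K , b) , (L , c)) = bounded₂ x y
      0<ε′    = *-pos 0<ε (recip-pos (ℚ.+-mono-< 0<B 0<B))
      (M , p) = cauchy x (ε ℚ.* recip (B ℚ.+ B)) 0<ε′
      (N , q) = cauchy y (ε ℚ.* recip (B ℚ.+ B)) 0<ε′
      KL = K ℕ.⊔ L
      MN = M ℕ.⊔ N
      toK = λ {m} (h : KL ℕ.⊔ MN ℕ.≤ m) → ℕ.m⊔n≤o⇒m≤o K L (ℕ.m⊔n≤o⇒m≤o KL MN h)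
      toL = λ {m} (h : KL ℕ.⊔ MN ℕ.≤ m) → ℕ.m⊔n≤o⇒n≤o K L (ℕ.m⊔n≤o⇒m≤o KL MN h)
      toM = λ {m} (h : KL ℕ.⊔ MN ℕ.≤ m) → ℕ.m⊔n≤o⇒m≤o M N (ℕ.m⊔n≤o⇒n≤o KL MN h)
      toN = λ {m} (h : KL ℕ.⊔ MN ℕ.≤ m) → ℕ.m⊔n≤o⇒n≤o M N (ℕ.m⊔n≤o⇒n≤o KL MN h)
  in KL ℕ.⊔ MN , λ m n hm hn → *-estimate (seq x m) (seq y m) (seq x n) (seq y n) 0<B (b m (toK hm)) (c n (toL hn))
       (p m n (toM hm) (toM hn)) (q m n (toN hm) (toN hn))

#0⇒bounded-below : ∀ {x} → x # 0ℝ → ∃[ δ ] 0ℚ ℚ.< δ × Eventually λ n → δ ℚ.≤ ∣ seq x n ∣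
#0⇒bounded-below {x} (inj₁ (mk< (ε , 0<ε , e))) = ε , 0<ε , eventually₁
  (λ n le → ℚ.≤-trans (≤-by₁ le (move ε (seq x n)))
    (ℚ.≤-trans (p≤∣p∣ (ℚ.- seq x n)) (ℚ.≤-reflexive (ℚ.∣-p∣≡∣p∣ (seq x n))))) e
  where
  open +-*-Solver
  move : ∀ ε p → ε ℚ.+ 0ℚ ≡ ℚ.- p ℚ.+ (p ℚ.+ ε)
  move = solve 2 (λ ε p → ε :+ con 0ℚ := (:- p) :+ (p :+ ε)) refl
#0⇒bounded-below {x} (inj₂ (mk< (ε , 0<ε , e))) = ε , 0<ε , eventually₁
  (λ n le → ℚ.≤-trans (subst (ℚ._≤ seq x n) (ℚ.+-identityˡ ε) le) (p≤∣p∣ (seq x n))) e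

inv : ∀ x → x # 0ℝ → ℝ
seq    (inv x x#0) n     = recip (seq x n)
cauchy (inv x x#0) ε 0<ε =
  let (δ , 0<δ , (M , b)) = #0⇒bounded-below {x} x#0
      (N , p) = cauchy x (ε ℚ.* (δ ℚ.* δ)) (*-pos 0<ε (*-pos 0<δ 0<δ))
  in M ℕ.⊔ N , λ m n hm hn → recip-estimate (seq x m) (seq x n) 0<δ
       (b m (ℕ.m⊔n≤o⇒m≤o M N hm)) (b n (ℕ.m⊔n≤o⇒m≤o M N hn))
       (p m n (ℕ.m⊔n≤o⇒n≤o M N hm) (ℕ.m⊔n≤o⇒n≤o M N hn))

infixl 7 _/_[_]

_/_[_] : ∀ x y → y # 0ℝ → ℝ
x / y [ y#0 ] = x * inv y y#0

≈-refl : ∀ {x} → x ≈ x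
≈-refl {x} = mk≈ λ ε 0<ε → always λ n → ∣p-p∣< (seq x n) (seq x n) refl 0<ε

≈-sym : ∀ {x y} → x ≈ y → y ≈ x
≈-sym {x} {y} (mk≈ x≈y) = mk≈ λ ε 0<ε → eventually₁ 
  (λ n → subst (ℚ._< ε) (∣p-q∣≡∣q-p∣ (seq x n) (seq y n))) (x≈y ε 0<ε)

≈-trans : ∀ {x y z} → x ≈ y → y ≈ z → x ≈ z
≈-trans {x} {y} {z} (mk≈ x≈y) (mk≈ y≈z) = mk≈ λ ε 0<ε → eventually₂
  (λ n p q → subst (ℚ._< ε) (cong ∣_∣ (telescope (seq x n) (seq y n) (seq z n)))
    (+-estimate (seq x n) (seq y n) (seq y n) (seq z n) p q))
  (x≈y _ (halve 0<ε)) (y≈z _ (halve 0<ε))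
  where
  open +-*-Solver
  telescope : ∀ p q r → (p ℚ.+ q) ℚ.- (q ℚ.+ r) ≡ p ℚ.- r
  telescope = solve 3 (λ p q r → (p :+ q) :- (q :+ r) := p :- r) refl

pointwise : ∀ {x y} → (∀ n → seq x n ≡ seq y n) → x ≈ y
pointwise {x} {y} e = mk≈ λ ε 0<ε → always λ n → ∣p-p∣< (seq x n) (seq y n) (e n) 0<ε

+-cong : ∀ {x x′ y y′} → x ≈ x′ → y ≈ y′ → x + y ≈ x′ + y′
+-cong {x} {x′} {y} {y′} (mk≈ p) (mk≈ q) = mk≈ λ ε 0<ε → eventually₂
  (λ n → +-estimate (seq x n) (seq y n) (seq x′ n) (seq y′ n)) (p _ (halve 0<ε)) (q _ (halve 0<ε))

-‿cong : ∀ {x x′} → x ≈ x′ → - x ≈ - x′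
-‿cong {x} {x′} (mk≈ p) = mk≈ λ ε 0<ε → eventually₁
  (λ n → neg-estimate (seq x n) (seq x′ n)) (p ε 0<ε)

*-cong : ∀ {x x′ y y′} → x ≈ x′ → y ≈ y′ → x * y ≈ x′ * y′
*-cong {x} {x′} {y} {y′} (mk≈ p) (mk≈ q) = mk≈ λ ε 0<ε →
  let (B , 0<B , b , c) = bounded₂ x y′
      0<ε′ = *-pos 0<ε (recip-pos (ℚ.+-mono-< 0<B 0<B))
  in eventually₄ (λ n → *-estimate (seq x n) (seq y n) (seq x′ n) (seq y′ n) 0<B) b c (p _ 0<ε′) (q _ 0<ε′)

ℝ-commutativeRing : CommutativeRing 0ℓ 0ℓ
ℝ-commutativeRing = record
  { Carrier = ℝ ; _≈_ = _≈_ ; _+_ = _+_ ; _*_ = _*_ ; -_ = -_ ; 0# = 0ℝ ; 1# = 1ℝ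
  ; isCommutativeRing = record
    { isRing = record
      { +-isAbelianGroup = record
        { isGroup = record
          { isMonoid = record
            { isSemigroup = record
              { isMagma = record
                { isEquivalence = record { refl = ≈-refl ; sym = ≈-sym ; trans = ≈-trans }
                ; ∙-cong = +-cong }
              ; assoc = λ x y z → pointwise λ n → ℚ.+-assoc (seq x n) (seq y n) (seq z n) }
            ; identity = (λ x → pointwise λ n → ℚ.+-identityˡ (seq x n))
                       , (λ x → pointwise λ n → ℚ.+-identityʳ (seq x n)) }
          ; inverse = (λ x → pointwise λ n → ℚ.+-inverseˡ (seq x n))
                    , (λ x → pointwise λ n → ℚ.+-inverseʳ (seq x n))
          ; ⁻¹-cong = -‿cong }
        ; comm = λ x y → pointwise λ n → ℚ.+-comm (seq x n) (seq y n) }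
      ; *-cong = *-cong
      ; *-assoc = λ x y z → pointwise λ n → ℚ.*-assoc (seq x n) (seq y n) (seq z n)
      ; *-identity = (λ x → pointwise λ n → ℚ.*-identityˡ (seq x n))
                   , (λ x → pointwise λ n → ℚ.*-identityʳ (seq x n))
      ; distrib = (λ x y z → pointwise λ n → ℚ.*-distribˡ-+ (seq x n) (seq y n) (seq z n))
                , (λ x y z → pointwise λ n → ℚ.*-distribʳ-+ (seq x n) (seq y n) (seq z n)) }
    ; *-comm = λ x y → pointwise λ n → ℚ.*-comm (seq x n) (seq y n) } }

module ≈-Reasoning = SetoidReasoning (CommutativeRing.setoid ℝ-commutativeRing)

*-inverseʳ : ∀ x (x#0 : x # 0ℝ) → x * inv x x#0 ≈ 1ℝ
*-inverseʳ x x#0 = mk≈ λ ε 0<ε →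
  let (δ , 0<δ , b) = #0⇒bounded-below {x} x#0
  in eventually₁ (λ n le → ∣p-p∣< (seq x n ℚ.* recip (seq x n)) 1ℚ (*-recip (∣∣-apart (seq x n) 0<δ le)) 0<ε) b

≈⇒≤ : ∀ {x y} → x ≈ y → x ≤ y
≈⇒≤ {x} {y} (mk≈ x≈y) = mk≤ λ ε 0<ε → eventually₁
  (λ n p → <-by₁ (ℚ.≤-<-trans (p≤∣p∣ (seq x n ℚ.- seq y n)) p) (move (seq x n) (seq y n) ε))
  (x≈y ε 0<ε)
  where
  open +-*-Solver
  move : ∀ p q ε → p ℚ.+ ε ≡ (q ℚ.+ ε) ℚ.+ (p ℚ.- q)
  move = solve 3 (λ p q ε → p :+ ε := (q :+ ε) :+ (p :- q)) refl

≤-antisym : ∀ {x y} → x ≤ y → y ≤ x → x ≈ y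
≤-antisym {x} {y} (mk≤ p) (mk≤ q) = mk≈ λ ε 0<ε → eventually₂
  (λ n p q → ∣∣< (<-by₁ p (move (seq x n) (seq y n) ε)) (<-by₁ q (move′ (seq x n) (seq y n) ε)))
  (p ε 0<ε) (q ε 0<ε)
  where
  open +-*-Solver
  move : ∀ p q ε → (p ℚ.- q) ℚ.+ (q ℚ.+ ε) ≡ ε ℚ.+ p
  move = solve 3 (λ p q ε → (p :- q) :+ (q :+ ε) := ε :+ p) refl
  move′ : ∀ p q ε → ℚ.- (p ℚ.- q) ℚ.+ (p ℚ.+ ε) ≡ ε ℚ.+ q
  move′ = solve 3 (λ p q ε → (:- (p :- q)) :+ (p :+ ε) := ε :+ q) refl

≤-trans : ∀ {x y z} → x ≤ y → y ≤ z → x ≤ z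
≤-trans {x} {y} {z} (mk≤ p) (mk≤ q) = mk≤ λ ε 0<ε → eventually₂
  (λ n p q → <-by₁ (ℚ.+-mono-< p q) (move (seq x n) (seq y n) (seq z n) ε))
  (p _ (halve 0<ε)) (q _ (halve 0<ε))
  where
  open +-*-Solver
  move : ∀ p q r ε → p ℚ.+ ((q ℚ.+ ½ ℚ.* ε) ℚ.+ (r ℚ.+ ½ ℚ.* ε)) ≡ (r ℚ.+ ε) ℚ.+ (p ℚ.+ q)
  move = solve 4 (λ p q r ε →
    p :+ ((q :+ con ½ :* ε) :+ (r :+ con ½ :* ε)) := (r :+ ε) :+ (p :+ q)) refl

<⇒≤ : ∀ {x y} → x < y → x ≤ y
<⇒≤ {x} {y} (mk< (δ , 0<δ , p)) = mk≤ λ ε 0<ε → eventually₁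
  (λ n p → <-by₁ (ℚ.+-mono-≤-< p (ℚ.+-mono-< 0<δ 0<ε)) (move (seq x n) (seq y n) δ ε)) p
  where
  open +-*-Solver
  move : ∀ p q δ ε → p ℚ.+ (q ℚ.+ (δ ℚ.+ ε)) ≡ (q ℚ.+ ε) ℚ.+ ((p ℚ.+ δ) ℚ.+ (0ℚ ℚ.+ 0ℚ))
  move = solve 4 (λ p q δ ε → p :+ (q :+ (δ :+ ε)) :=
    (q :+ ε) :+ ((p :+ δ) :+ (con 0ℚ :+ con 0ℚ))) refl

<-≤-trans : ∀ {x y z} → x < y → y ≤ z → x < z
<-≤-trans {x} {y} {z} (mk< (ε , 0<ε , p)) (mk≤ q) = mk< (½ ℚ.* ε , halve 0<ε , eventually₂
  (λ n p q → ≤-by₁ (ℚ.+-mono-≤ p (ℚ.<⇒≤ q)) (move (seq x n) (seq y n) (seq z n) ε))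
  p (q _ (halve 0<ε)))
  where
  open +-*-Solver
  move : ∀ p q r ε → (p ℚ.+ ½ ℚ.* ε) ℚ.+ (q ℚ.+ (r ℚ.+ ½ ℚ.* ε)) ≡ r ℚ.+ ((p ℚ.+ ε) ℚ.+ q)
  move = solve 4 (λ p q r ε →
    (p :+ con ½ :* ε) :+ (q :+ (r :+ con ½ :* ε)) := r :+ ((p :+ ε) :+ q)) refl

≤-<-trans : ∀ {x y z} → x ≤ y → y < z → x < z
≤-<-trans {x} {y} {z} (mk≤ p) (mk< (ε , 0<ε , q)) = mk< (½ ℚ.* ε , halve 0<ε , eventually₂
  (λ n p q → ≤-by₁ (ℚ.+-mono-≤ (ℚ.<⇒≤ p) q) (move (seq x n) (seq y n) (seq z n) ε))
  (p _ (halve 0<ε)) q)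
  where
  open +-*-Solver
  move : ∀ p q r ε → (p ℚ.+ ½ ℚ.* ε) ℚ.+ ((q ℚ.+ ½ ℚ.* ε) ℚ.+ r) ≡ r ℚ.+ (p ℚ.+ (q ℚ.+ ε))
  move = solve 4 (λ p q r ε →
    (p :+ con ½ :* ε) :+ ((q :+ con ½ :* ε) :+ r) := r :+ (p :+ (q :+ ε))) refl

<-irrefl : ∀ {x} → ¬ x < x
<-irrefl {x} (mk< (ε , 0<ε , p)) = let (n , le) = now p in
  ℚ.<-irrefl refl (ℚ.<-≤-trans (<-by₁ 0<ε (sym (ℚ.+-identityʳ (seq x n ℚ.+ ε)))) le)

<-respʳ-≈ : ∀ {x y z} → y ≈ z → x < y → x < z
<-respʳ-≈ e p = <-≤-trans p (≈⇒≤ e)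

<-respˡ-≈ : ∀ {x y z} → x ≈ y → x < z → y < z
<-respˡ-≈ e p = ≤-<-trans (≈⇒≤ (≈-sym e)) p

≤-respʳ-≈ : ∀ {x y z} → y ≈ z → x ≤ y → x ≤ z
≤-respʳ-≈ e p = ≤-trans p (≈⇒≤ e)

≤-respˡ-≈ : ∀ {x y z} → x ≈ y → x ≤ z → y ≤ z
≤-respˡ-≈ e p = ≤-trans (≈⇒≤ (≈-sym e)) p

+-mono-≤ : ∀ {x x′ y y′} → x ≤ x′ → y ≤ y′ → x + y ≤ x′ + y′
+-mono-≤ {x} {x′} {y} {y′} (mk≤ p) (mk≤ q) = mk≤ λ ε 0<ε → eventually₂
  (λ n p q → subst (seq x n ℚ.+ seq y n ℚ.<_) (move (seq x′ n) (seq y′ n) ε) (ℚ.+-mono-< p q))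
  (p _ (halve 0<ε)) (q _ (halve 0<ε))
  where
  open +-*-Solver
  move : ∀ p q ε → (p ℚ.+ ½ ℚ.* ε) ℚ.+ (q ℚ.+ ½ ℚ.* ε) ≡ (p ℚ.+ q) ℚ.+ ε
  move = solve 3 (λ p q ε → (p :+ con ½ :* ε) :+ (q :+ con ½ :* ε) := (p :+ q) :+ ε) refl

+-mono-<-≤ : ∀ {x x′ y y′} → x < x′ → y ≤ y′ → x + y < x′ + y′
+-mono-<-≤ {x} {x′} {y} {y′} (mk< (ε , 0<ε , p)) (mk≤ q) = mk< (½ ℚ.* ε , halve 0<ε , eventually₂
  (λ n p q → ≤-by₁ (ℚ.+-mono-≤ p (ℚ.<⇒≤ q)) (move (seq x n) (seq x′ n) (seq y n) (seq y′ n) ε))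
  p (q _ (halve 0<ε)))
  where
  open +-*-Solver
  move : ∀ p p′ q q′ ε → ((p ℚ.+ q) ℚ.+ ½ ℚ.* ε) ℚ.+ (p′ ℚ.+ (q′ ℚ.+ ½ ℚ.* ε))
                       ≡ (p′ ℚ.+ q′) ℚ.+ ((p ℚ.+ ε) ℚ.+ q)
  move = solve 5 (λ p p′ q q′ ε → ((p :+ q) :+ con ½ :* ε) :+ (p′ :+ (q′ :+ con ½ :* ε))
                               := (p′ :+ q′) :+ ((p :+ ε) :+ q)) refl

0<*0< : ∀ {x y} → 0ℝ < x → 0ℝ < y → 0ℝ < x * y
0<*0< {x} {y} (mk< (δ , 0<δ , p)) (mk< (ε , 0<ε , q)) = mk< (δ ℚ.* ε , *-pos 0<δ 0<ε , eventually₂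
  (λ n p q → subst (ℚ._≤ seq x n ℚ.* seq y n) (sym (ℚ.+-identityˡ (δ ℚ.* ε)))
    (let δ≤ = subst (ℚ._≤ seq x n) (ℚ.+-identityˡ δ) p in
     *-mono-≤ (ℚ.<⇒≤ 0<ε) (ℚ.≤-trans (ℚ.<⇒≤ 0<δ) δ≤) δ≤ (subst (ℚ._≤ seq y n) (ℚ.+-identityˡ ε) q)))
  p q)

0≤*0≤ : ∀ {x y} → 0ℝ ≤ x → 0ℝ ≤ y → 0ℝ ≤ x * y
0≤*0≤ {x} {y} (mk≤ p) (mk≤ q) = mk≤ λ ε 0<ε →
  let (B , 0<B , b , c) = bounded₂ x y
      0<ε′ = *-pos 0<ε (recip-pos 0<B)
  in eventually₄ (λ n → nonNeg-estimate (seq x n) (seq y n) 0<B 0<ε) b c (p _ 0<ε′) (q _ 0<ε′)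

ι-cong : ∀ {p q} → p ≡ q → ι p ≈ ι q
ι-cong refl = ≈-refl

ι-mono-≤ : ∀ {p q} → p ℚ.≤ q → ι p ≤ ι q
ι-mono-≤ {p} {q} p≤q = mk≤ λ ε 0<ε → always λ n →
  subst (ℚ._< q ℚ.+ ε) (ℚ.+-identityʳ p) (ℚ.+-mono-≤-< p≤q 0<ε)

ι-mono-< : ∀ {p q} → p ℚ.< q → ι p < ι q
ι-mono-< {p} {q} p<q = mk< (q ℚ.- p ,
  <-by₁ p<q (solve 2 (λ p q → con 0ℚ :+ q := (q :- p) :+ p) refl p q) ,
  always λ n → ℚ.≤-reflexive (solve 2 (λ p q → p :+ (q :- p) := q) refl p q))
  where open +-*-Solver

ι-cancel-< : ∀ {p q} → ι p < ι q → p ℚ.< q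
ι-cancel-< {p} (mk< (ε , 0<ε , e)) = ℚ.<-≤-trans
  (<-by₁ 0<ε (sym (ℚ.+-identityʳ (p ℚ.+ ε)))) (proj₂ (now e))

ι-cancel-≤ : ∀ {p q} → ι p ≤ ι q → p ℚ.≤ q
ι-cancel-≤ p≤q = ℚ.≮⇒≥ λ q<p → <-irrefl (<-≤-trans (ι-mono-< q<p) p≤q)

≤⇒0≤- : ∀ {x y} → x ≤ y → 0ℝ ≤ y - x
≤⇒0≤- {x} p = ≤-respˡ-≈ (CommutativeRing.-‿inverseʳ ℝ-commutativeRing x) (+-mono-≤ p (≈⇒≤ ≈-refl))

0≤-⇒≤ : ∀ {x y} → 0ℝ ≤ y - x → x ≤ y
0≤-⇒≤ {x} {y} p = ≤-respʳ-≈ cancel (≤-respˡ-≈ (CommutativeRing.+-identityˡ ℝ-commutativeRing x)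
  (+-mono-≤ p (≈⇒≤ ≈-refl)))
  where
  open +-*-Solver
  cancel : (y - x) + x ≈ y
  cancel = pointwise λ n → solve 2 (λ p q → (q :- p) :+ p := q) refl (seq x n) (seq y n)

neg-# : ∀ {x} → x # 0ℝ → (- x) # 0ℝ
neg-# {x} (inj₁ p) = inj₂ (<-respˡ-≈ e₁ (<-respʳ-≈ e₂ (+-mono-<-≤ p (≈⇒≤ (≈-refl { - x })))))
  where
  e₁ = CommutativeRing.-‿inverseʳ ℝ-commutativeRing x
  e₂ = CommutativeRing.+-identityˡ ℝ-commutativeRing (- x)
neg-# {x} (inj₂ p) = inj₁ (<-respʳ-≈ e₁ (<-respˡ-≈ e₂ (+-mono-<-≤ p (≈⇒≤ (≈-refl { - x })))))
  where
  e₁ = CommutativeRing.-‿inverseʳ ℝ-commutativeRing x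
  e₂ = CommutativeRing.+-identityˡ ℝ-commutativeRing (- x)

#-respˡ-≈ : ∀ {x y z} → x ≈ y → x # z → y # z
#-respˡ-≈ e (inj₁ p) = inj₁ (<-respˡ-≈ e p)
#-respˡ-≈ e (inj₂ p) = inj₂ (<-respʳ-≈ e p)

inv-pos : ∀ {x} → 0ℝ < x → ∀ x#0 → 0ℝ < inv x x#0
inv-pos {x} (mk< (δ , 0<δ , p)) x#0 =
  let (B , 0<B , b) = bounded x
  in mk< (recip B , recip-pos 0<B , eventually₂
    (λ n p b → subst (ℚ._≤ recip (seq x n)) (sym (ℚ.+-identityˡ (recip B)))
      (recip-antimono (ℚ.<-≤-trans 0<δ (subst (ℚ._≤ seq x n) (ℚ.+-identityˡ δ) p))
        (ℚ.≤-trans (p≤∣p∣ (seq x n)) b)))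
    p b)

*-cancelʳ : ∀ {x x′ y} → y # 0ℝ → x * y ≈ x′ * y → x ≈ x′
*-cancelʳ {x} {x′} {y} y#0 e = begin
  x                       ≈⟨ expand x ⟨
  (x * y) * inv y y#0     ≈⟨ *-cong e ≈-refl ⟩
  (x′ * y) * inv y y#0    ≈⟨ expand x′ ⟩
  x′                      ∎
  where
  open ≈-Reasoning
  expand : ∀ x → (x * y) * inv y y#0 ≈ x
  expand x = ≈-trans (CommutativeRing.*-assoc ℝ-commutativeRing x y (inv y y#0))
    (≈-trans (*-cong ≈-refl (*-inverseʳ y y#0)) (CommutativeRing.*-identityʳ ℝ-commutativeRing x))

/-* : ∀ x {y} y#0 → x / y [ y#0 ] * y ≈ x
/-* x {y} y#0 = begin
  (x * inv y y#0) * y   ≈⟨ (pointwise λ n → solve 3 (λ p q r → (p :* r) :* q := p :* (q :* r)) refl (seq x n) (seq y n) (seq (inv y y#0) n)) ⟩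
  x * (y * inv y y#0)   ≈⟨ *-cong ≈-refl (*-inverseʳ y y#0) ⟩
  x * 1ℝ                ≈⟨ CommutativeRing.*-identityʳ ℝ-commutativeRing x ⟩
  x                     ∎
  where
  open ≈-Reasoning
  open +-*-Solver

/-cross : ∀ {x y x′ y′} y#0 y′#0 → x / y [ y#0 ] ≈ x′ / y′ [ y′#0 ] → x * y′ ≈ x′ * y
/-cross {x} {y} {x′} {y′} y#0 y′#0 e = begin
  x * y′                      ≈⟨ *-cong (/-* x y#0) ≈-refl ⟨
  x / y [ y#0 ] * y * y′      ≈⟨ *-cong (*-cong e ≈-refl) ≈-refl ⟩
  x′ / y′ [ y′#0 ] * y * y′   ≈⟨ (pointwise λ n → solve 3 (λ p q r → (p :* q) :* r := (p :* r) :* q) refl (seq (x′ / y′ [ y′#0 ]) n) (seq y n) (seq y′ n)) ⟩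
  x′ / y′ [ y′#0 ] * y′ * y   ≈⟨ *-cong (/-* x′ y′#0) ≈-refl ⟩
  x′ * y                      ∎
  where
  open ≈-Reasoning
  open +-*-Solver

cross-/ : ∀ {x y x′ y′} y#0 y′#0 → x * y′ ≈ x′ * y → x / y [ y#0 ] ≈ x′ / y′ [ y′#0 ]
cross-/ {x} {y} {x′} {y′} y#0 y′#0 e = *-cancelʳ y#0 (*-cancelʳ y′#0 (begin
  x / y [ y#0 ] * y * y′      ≈⟨ *-cong (/-* x y#0) ≈-refl ⟩
  x * y′                      ≈⟨ e ⟩
  x′ * y                      ≈⟨ *-cong (/-* x′ y′#0) ≈-refl ⟨
  x′ / y′ [ y′#0 ] * y′ * y   ≈⟨ (pointwise λ n → solve 3 (λ p q r → (p :* r) :* q := (p :* q) :* r) refl (seq (x′ / y′ [ y′#0 ]) n) (seq y n) (seq y′ n)) ⟩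
  x′ / y′ [ y′#0 ] * y * y′   ∎))
  where
  open ≈-Reasoning
  open +-*-Solver

0<-cancelʳ : ∀ {x y} → 0ℝ < y → 0ℝ < x * y → 0ℝ < x
0<-cancelʳ {x} {y} 0<y p = <-respʳ-≈ e (0<*0< p (inv-pos 0<y (inj₂ 0<y)))
  where
  e : x * y * inv y (inj₂ 0<y) ≈ x
  e = ≈-trans (CommutativeRing.*-assoc ℝ-commutativeRing x y _)
    (≈-trans (*-cong ≈-refl (*-inverseʳ y (inj₂ 0<y))) (CommutativeRing.*-identityʳ ℝ-commutativeRing x))

0≤-cancelʳ : ∀ {x y} → 0ℝ < y → 0ℝ ≤ x * y → 0ℝ ≤ x
0≤-cancelʳ {x} {y} 0<y p = ≤-respʳ-≈ e (0≤*0≤ p (<⇒≤ (inv-pos 0<y (inj₂ 0<y))))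
  where
  e : x * y * inv y (inj₂ 0<y) ≈ x
  e = ≈-trans (CommutativeRing.*-assoc ℝ-commutativeRing x y _)
    (≈-trans (*-cong ≈-refl (*-inverseʳ y (inj₂ 0<y))) (CommutativeRing.*-identityʳ ℝ-commutativeRing x))

_∈[-1,1] : ℝ → Set
x ∈[-1,1] = - 1ℝ ≤ x × x ≤ 1ℝ

-- mat a b c d is the matrix with rows (a b) and (c d).
record 𝕄 : Set where
  constructor mat
  field a b c d : ℚ

infixr 9 _∘_

_∘_ : 𝕄 → 𝕄 → 𝕄
mat a b c d ∘ mat a′ b′ c′ d′ = mat
  (a ℚ.* a′ ℚ.+ b ℚ.* c′) (a ℚ.* b′ ℚ.+ b ℚ.* d′)
  (c ℚ.* a′ ℚ.+ d ℚ.* c′) (c ℚ.* b′ ℚ.+ d ℚ.* d′)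

det : 𝕄 → ℚ
det (mat a b c d) = a ℚ.* d ℚ.- b ℚ.* c

adjugate : 𝕄 → 𝕄
adjugate (mat a b c d) = mat d (ℚ.- b) (ℚ.- c) a

inverse : ∀ μ → .{{_ : ℚ.NonZero (det μ)}} → 𝕄
inverse μ = scale (ℚ.1/ det μ) (adjugate μ)
  where
  scale : ℚ → 𝕄 → 𝕄
  scale k (mat a b c d) = mat (k ℚ.* a) (k ℚ.* b) (k ℚ.* c) (k ℚ.* d)

num den : 𝕄 → ℝ → ℝ
num (mat a b _ _) x = ι a * x + ι b
den (mat _ _ c d) x = ι c * x + ι d

apply : ∀ μ x → den μ x # 0ℝ → ℝ
apply μ x nz = num μ x / den μ x [ nz ]

Bounded : 𝕄 → Set
Bounded μ = ∀ x → x ∈[-1,1] → den μ x # 0ℝ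

-- s ∈image μ: s lies in μ([-1,1]).
_∈image_ : ℝ → 𝕄 → Set
s ∈image μ = ∃[ x ] x ∈[-1,1] × Σ[ nz ∈ den μ x # 0ℝ ] s ≈ apply μ x nz

data DIG : Set where
  L R M : DIG

⟦_⟧ : DIG → 𝕄
⟦ L ⟧ = mat ½ -½ ½ (+ 3 ℚ./ 2)
⟦ R ⟧ = mat ½ ½ -½ (+ 3 ℚ./ 2)
⟦ M ⟧ = mat 1ℚ 0ℚ 0ℚ (+ 3 ℚ./ 1)

det-nonZero : ∀ φ → ℚ.NonZero (det ⟦ φ ⟧)
det-nonZero L = _
det-nonZero R = _
det-nonZero M = _

⟦_⟧⁻¹ : DIG → 𝕄
⟦ φ ⟧⁻¹ = inverse ⟦ φ ⟧ {{det-nonZero φ}}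

-- Streams are represented by their sequence of entries, so that Cons, hd
-- and tl satisfy the stream laws by computation and bisimilarity is
-- equality of all entries.
DIGω : Set
DIGω = ℕ → DIG

hd : DIGω → DIG
hd α = α 0

tl : DIGω → DIGω
tl α n = α (suc n)

Cons : DIG → DIGω → DIGω
Cons φ α zero    = φ
Cons φ α (suc n) = α n

infix 4 _≅_

_≅_ : Rel DIGω 0ℓ
α ≅ β = ∀ n → α n ≡ β n

Incl : 𝕄 → DIG → Set
Incl μ φ = Bounded μ × (∀ s → s ∈image μ → s ∈image ⟦ φ ⟧)

module Incl-Decidable where
  open +-*-Solver using (solve; _:=_; _:+_; _:*_; _:-_; :-_; con)
  open ≈-Reasoning

  linear-nonNeg : ∀ {u v x} → x ∈[-1,1] →
                  0ℚ ℚ.≤ u ℚ.* 1ℚ ℚ.+ v → 0ℚ ℚ.≤ u ℚ.* (ℚ.- 1ℚ) ℚ.+ v →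
                  0ℝ ≤ ι u * x + ι v
  linear-nonNeg {u} {v} {x} (-1≤x , x≤1) p q = ≤-respʳ-≈ interpolate
    (0≤*0≤ (ι-mono-≤ (ℚ.<⇒≤ 0<½)) (≤-respˡ-≈ (pointwise λ _ → refl)
      (+-mono-≤ (0≤*0≤ (≤⇒0≤- -1≤x) (ι-mono-≤ p)) (0≤*0≤ (≤⇒0≤- x≤1) (ι-mono-≤ q)))))
    where
    interpolate : ι ½ * ((x - (- 1ℝ)) * ι (u ℚ.* 1ℚ ℚ.+ v) + (1ℝ - x) * ι (u ℚ.* (ℚ.- 1ℚ) ℚ.+ v))
                  ≈ ι u * x + ι v
    interpolate = pointwise λ n → solve 3 (λ u v x →
      con ½ :* ((x :- (:- con 1ℚ)) :* (u :* con 1ℚ :+ v) :+ (con 1ℚ :- x) :* (u :* (:- con 1ℚ) :+ v))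
      := u :* x :+ v) refl u v (seq x n)

  linear-pos : ∀ {u v x} → x ∈[-1,1] →
               0ℚ ℚ.< u ℚ.* 1ℚ ℚ.+ v → 0ℚ ℚ.< u ℚ.* (ℚ.- 1ℚ) ℚ.+ v →
               0ℝ < ι u * x + ι v
  linear-pos {u} {v} {x} x∈ p q = <-≤-trans (ι-mono-< 0<m) (0≤-⇒≤ (≤-respʳ-≈ e (linear-nonNeg x∈
      (shift (u ℚ.* 1ℚ) (ℚ.p⊓q≤p p′ q′)) (shift (u ℚ.* (ℚ.- 1ℚ)) (ℚ.p⊓q≤q p′ q′)))))
    where
    p′ = u ℚ.* 1ℚ ℚ.+ v
    q′ = u ℚ.* (ℚ.- 1ℚ) ℚ.+ v
    m  = p′ ℚ.⊓ q′
    0<m : 0ℚ ℚ.< m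
    0<m with ℚ.⊓-sel p′ q′
    ... | inj₁ e = subst (0ℚ ℚ.<_) (sym e) p
    ... | inj₂ e = subst (0ℚ ℚ.<_) (sym e) q
    shift : ∀ w → m ℚ.≤ w ℚ.+ v → 0ℚ ℚ.≤ w ℚ.+ (v ℚ.- m)
    shift w le = ≤-by₁ le (solve 3 (λ w v m → con 0ℚ :+ (w :+ v) := (w :+ (v :- m)) :+ m) refl w v m)
    e : ι u * x + ι (v ℚ.- m) ≈ (ι u * x + ι v) - ι m
    e = pointwise λ n → solve 4 (λ u v x m → u :* x :+ (v :- m) := (u :* x :+ v) :- m) refl u v (seq x n) m

  ι-∈ : ∀ {σ} → ℚ.- 1ℚ ℚ.≤ σ → σ ℚ.≤ 1ℚ → ι σ ∈[-1,1]
  ι-∈ p q = ≤-respˡ-≈ (pointwise λ _ → refl) (ι-mono-≤ p) , ι-mono-≤ q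

  -1≤1 : ℚ.- 1ℚ ℚ.≤ 1ℚ
  -1≤1 = toWitness {a? = ℚ.- 1ℚ ℚ.≤? 1ℚ} _

  1∈ : ι 1ℚ ∈[-1,1]
  1∈ = ι-∈ -1≤1 ℚ.≤-refl

  -1∈ : ι (ℚ.- 1ℚ) ∈[-1,1]
  -1∈ = ι-∈ ℚ.≤-refl -1≤1

  -- Orientation-preserving maps, with denominator positive on [-1,1].
  Proper : 𝕄 → Set
  Proper ν@(mat _ _ c d) = 0ℚ ℚ.< det ν × 0ℚ ℚ.< c ℚ.* 1ℚ ℚ.+ d × 0ℚ ℚ.< c ℚ.* (ℚ.- 1ℚ) ℚ.+ d

  proper? : ∀ ν → Dec (Proper ν)
  proper? ν = (_ ℚ.<? _) ×-dec (_ ℚ.<? _) ×-dec (_ ℚ.<? _)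

  digit-proper : ∀ φ → Proper ⟦ φ ⟧
  digit-proper L = toWitness {a? = proper? ⟦ L ⟧} _
  digit-proper R = toWitness {a? = proper? ⟦ R ⟧} _
  digit-proper M = toWitness {a? = proper? ⟦ M ⟧} _

  -- The condition on μ and ν⁻¹ ∘ μ at an endpoint σ, for positive
  -- denominators.
  Endpoint : 𝕄 → 𝕄 → ℚ → Set
  Endpoint (mat _ _ c d) (mat A B C D) σ =
    0ℚ ℚ.< c ℚ.* σ ℚ.+ d × 0ℚ ℚ.< C ℚ.* σ ℚ.+ D ×
    A ℚ.* σ ℚ.+ B ℚ.≤ C ℚ.* σ ℚ.+ D × ℚ.- (C ℚ.* σ ℚ.+ D) ℚ.≤ A ℚ.* σ ℚ.+ B

  endpoint? : ∀ μ ψ σ → Dec (Endpoint μ ψ σ)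
  endpoint? _ _ _ = (_ ℚ.<? _) ×-dec (_ ℚ.<? _) ×-dec (_ ℚ.≤? _) ×-dec (_ ℚ.≤? _)

  Criterion : 𝕄 → 𝕄 → Set
  Criterion μ ν = Endpoint μ (adjugate ν ∘ μ) 1ℚ × Endpoint μ (adjugate ν ∘ μ) (ℚ.- 1ℚ)

  criterion? : ∀ μ ν → Dec (Criterion μ ν)
  criterion? μ ν = endpoint? μ (adjugate ν ∘ μ) 1ℚ ×-dec endpoint? μ (adjugate ν ∘ μ) (ℚ.- 1ℚ)

  Included : 𝕄 → 𝕄 → Set
  Included μ ν = Bounded μ × (∀ s → s ∈image μ → s ∈image ν)

  sound : ∀ μ ν → Proper ν → Criterion μ ν → Included μ ν
  sound μ@(mat a b c d) ν@(mat e f g h) (0<det , 0<gh , 0<gh′) ((p₁ , q₁ , r₁ , s₁) , (p₂ , q₂ , r₂ , s₂)) =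
    (λ x x∈ → inj₂ (linear-pos x∈ p₁ p₂)) ,
    λ s (x , x∈ , nz , s≈) → let open At x x∈ in
      y , y∈ , inj₂ 0<W , ≈-trans s≈ (cross-/ nz (inj₂ 0<W) cross)
    where
    ψ = adjugate ν ∘ μ
    A B C D : ℚ
    A = 𝕄.a ψ
    B = 𝕄.b ψ
    C = 𝕄.c ψ
    D = 𝕄.d ψ
    module At (x : ℝ) (x∈ : x ∈[-1,1]) where
      0<Y : 0ℝ < den ψ x
      0<Y = linear-pos x∈ q₁ q₂
      y : ℝ
      y = num ψ x / den ψ x [ inj₂ 0<Y ]
      y*Y : y * den ψ x ≈ num ψ x
      y*Y = /-* (num ψ x) (inj₂ 0<Y)
      upper : ∀ σ → A ℚ.* σ ℚ.+ B ℚ.≤ C ℚ.* σ ℚ.+ D → 0ℚ ℚ.≤ (C ℚ.- A) ℚ.* σ ℚ.+ (D ℚ.- B)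
      upper σ le = ≤-by₁ le (solve 5 (λ A B C D σ →
        con 0ℚ :+ (C :* σ :+ D) := ((C :- A) :* σ :+ (D :- B)) :+ (A :* σ :+ B)) refl A B C D σ)
      lower : ∀ σ → ℚ.- (C ℚ.* σ ℚ.+ D) ℚ.≤ A ℚ.* σ ℚ.+ B → 0ℚ ℚ.≤ (A ℚ.+ C) ℚ.* σ ℚ.+ (B ℚ.+ D)
      lower σ le = ≤-by₁ le (solve 5 (λ A B C D σ →
        con 0ℚ :+ (A :* σ :+ B) := ((A :+ C) :* σ :+ (B :+ D)) :+ (:- (C :* σ :+ D))) refl A B C D σ)
      y∈ : y ∈[-1,1]
      y∈ = 0≤-⇒≤ (0≤-cancelʳ 0<Y (≤-respʳ-≈ e₂ (linear-nonNeg x∈ (lower 1ℚ s₁) (lower (ℚ.- 1ℚ) s₂))))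
         , 0≤-⇒≤ (0≤-cancelʳ 0<Y (≤-respʳ-≈ e₁ (linear-nonNeg x∈ (upper 1ℚ r₁) (upper (ℚ.- 1ℚ) r₂))))
        where
        e₁ : ι (C ℚ.- A) * x + ι (D ℚ.- B) ≈ (1ℝ - y) * den ψ x
        e₁ = begin
          ι (C ℚ.- A) * x + ι (D ℚ.- B)   ≈⟨ (pointwise λ n → solve 5 (λ A B C D x →
                                                  (C :- A) :* x :+ (D :- B) := (C :* x :+ D) :- (A :* x :+ B)) refl A B C D (seq x n)) ⟩
          den ψ x - num ψ x               ≈⟨ +-cong ≈-refl (-‿cong y*Y) ⟨
          den ψ x - y * den ψ x           ≈⟨ (pointwise λ n → solve 2 (λ y Y → Y :- y :* Y := (con 1ℚ :- y) :* Y) refl (seq y n) (seq (den ψ x) n)) ⟩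
          (1ℝ - y) * den ψ x              ∎
        e₂ : ι (A ℚ.+ C) * x + ι (B ℚ.+ D) ≈ (y - (- 1ℝ)) * den ψ x
        e₂ = begin
          ι (A ℚ.+ C) * x + ι (B ℚ.+ D)   ≈⟨ (pointwise λ n → solve 5 (λ A B C D x →
                                                  (A :+ C) :* x :+ (B :+ D) := (A :* x :+ B) :+ (C :* x :+ D)) refl A B C D (seq x n)) ⟩
          num ψ x + den ψ x               ≈⟨ +-cong y*Y ≈-refl ⟨
          y * den ψ x + den ψ x           ≈⟨ (pointwise λ n → solve 2 (λ y Y → y :* Y :+ Y := (y :- (:- con 1ℚ)) :* Y) refl (seq y n) (seq (den ψ x) n)) ⟩
          (y - (- 1ℝ)) * den ψ x          ∎
      0<W : 0ℝ < den ν y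
      0<W = linear-pos y∈ 0<gh 0<gh′
      cross : num μ x * den ν y ≈ num ν y * den μ x
      cross = *-cancelʳ (inj₂ 0<Y) (begin
        num μ x * den ν y * den ψ x
          ≈⟨ (pointwise λ n → solve 5 (λ P g h y Y → P :* (g :* y :+ h) :* Y := P :* (g :* (y :* Y) :+ h :* Y))
               refl (seq (num μ x) n) g h (seq y n) (seq (den ψ x) n)) ⟩
        num μ x * (ι g * (y * den ψ x) + ι h * den ψ x)
          ≈⟨ *-cong ≈-refl (+-cong (*-cong ≈-refl y*Y) ≈-refl) ⟩
        num μ x * (ι g * num ψ x + ι h * den ψ x)
          ≈⟨ (pointwise λ n → solve 9 (λ a b c d e f g h x →
                (a :* x :+ b) :* (g :* ((h :* a :+ (:- f) :* c) :* x :+ (h :* b :+ (:- f) :* d))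
                               :+ h :* (((:- g) :* a :+ e :* c) :* x :+ ((:- g) :* b :+ e :* d)))
                := (e :* ((h :* a :+ (:- f) :* c) :* x :+ (h :* b :+ (:- f) :* d))
                 :+ f :* (((:- g) :* a :+ e :* c) :* x :+ ((:- g) :* b :+ e :* d))) :* (c :* x :+ d))
               refl a b c d e f g h (seq x n)) ⟩
        (ι e * num ψ x + ι f * den ψ x) * den μ x
          ≈⟨ *-cong (+-cong (*-cong ≈-refl y*Y) ≈-refl) ≈-refl ⟨
        (ι e * (y * den ψ x) + ι f * den ψ x) * den μ x
          ≈⟨ (pointwise λ n → solve 5 (λ Q e f y Y → (e :* (y :* Y) :+ f :* Y) :* Q := (e :* y :+ f) :* Q :* Y)
               refl (seq (den μ x) n) e f (seq y n) (seq (den ψ x) n)) ⟩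
        num ν y * den μ x * den ψ x ∎)

  endpoint-complete : ∀ μ ν → Proper ν → (∀ s → s ∈image μ → s ∈image ν) →
                      ∀ σ → ι σ ∈[-1,1] → 0ℚ ℚ.< 𝕄.c μ ℚ.* σ ℚ.+ 𝕄.d μ →
                      Endpoint μ (adjugate ν ∘ μ) σ
  endpoint-complete μ@(mat a b c d) ν@(mat e f g h) (0<det , 0<gh , 0<gh′) incl σ σ∈ 0<Qσ =
    go (incl _ (ι σ , σ∈ , inj₂ 0<Q , ≈-refl))
    where
    ψ = adjugate ν ∘ μ
    A B C D : ℚ
    A = 𝕄.a ψ
    B = 𝕄.b ψ
    C = 𝕄.c ψ
    D = 𝕄.d ψ
    0<Q : 0ℝ < den μ (ι σ)
    0<Q = <-respʳ-≈ (pointwise λ _ → refl) (ι-mono-< 0<Qσ)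
    go : apply μ (ι σ) (inj₂ 0<Q) ∈image ν → Endpoint μ ψ σ
    go (y , y∈@(-1≤y , y≤1) , nz , e₀) = 0<Qσ , ι-cancel-< (<-respʳ-≈ ιY 0<Y) ,
      ι-cancel-≤ (≤-respˡ-≈ ιX (≤-respʳ-≈ ιY (0≤-⇒≤ (≤-respʳ-≈ e₁ (0≤*0≤ (≤⇒0≤- y≤1) (<⇒≤ 0<Y)))))) ,
      ι-cancel-≤ (≤-respˡ-≈ ι-Y (≤-respʳ-≈ ιX (0≤-⇒≤ (≤-respʳ-≈ e₂ (0≤*0≤ (≤⇒0≤- -1≤y) (<⇒≤ 0<Y))))))
      where
      x = ι σ
      ιX : num ψ x ≈ ι (A ℚ.* σ ℚ.+ B)
      ιX = pointwise λ _ → refl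
      ιY : den ψ x ≈ ι (C ℚ.* σ ℚ.+ D)
      ιY = pointwise λ _ → refl
      ι-Y : - den ψ x ≈ ι (ℚ.- (C ℚ.* σ ℚ.+ D))
      ι-Y = pointwise λ _ → refl
      0<W : 0ℝ < den ν y
      0<W = linear-pos y∈ 0<gh 0<gh′
      cross : num μ x * den ν y ≈ num ν y * den μ x
      cross = /-cross (inj₂ 0<Q) nz e₀
      det-Q : ι (det ν) * den μ x ≈ den ψ x * den ν y
      det-Q = begin
        ι (det ν) * den μ x
          ≈⟨ (pointwise λ n → solve 6 (λ e f g h y Q →
                 (e :* h :- f :* g) :* Q := e :* (Q :* (g :* y :+ h)) :- g :* ((e :* y :+ f) :* Q))
               refl e f g h (seq y n) (seq (den μ x) n)) ⟩
        ι e * (den μ x * den ν y) - ι g * (num ν y * den μ x)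
          ≈⟨ +-cong ≈-refl (-‿cong (*-cong ≈-refl cross)) ⟨
        ι e * (den μ x * den ν y) - ι g * (num μ x * den ν y)
          ≈⟨ (pointwise λ n → solve 8 (λ a b c d e g x W →
                 e :* ((c :* x :+ d) :* W) :- g :* ((a :* x :+ b) :* W)
                 := (((:- g) :* a :+ e :* c) :* x :+ ((:- g) :* b :+ e :* d)) :* W)
               refl a b c d e g σ (seq (den ν y) n)) ⟩
        den ψ x * den ν y ∎
      0<Y : 0ℝ < den ψ x
      0<Y = 0<-cancelʳ 0<W (<-respʳ-≈ det-Q (0<*0< (ι-mono-< 0<det) 0<Q))
      y*Y : y * den ψ x ≈ num ψ x
      y*Y = begin
        y * den ψ x
          ≈⟨ (pointwise λ n → solve 10 (λ a b c d e f g h x y →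
                 y :* (((:- g) :* a :+ e :* c) :* x :+ ((:- g) :* b :+ e :* d))
                 := ((h :* a :+ (:- f) :* c) :* x :+ (h :* b :+ (:- f) :* d))
                 :+ ((e :* y :+ f) :* (c :* x :+ d) :- (a :* x :+ b) :* (g :* y :+ h)))
               refl a b c d e f g h σ (seq y n)) ⟩
        num ψ x + (num ν y * den μ x - num μ x * den ν y)
          ≈⟨ +-cong ≈-refl (+-cong ≈-refl (-‿cong cross)) ⟩
        num ψ x + (num ν y * den μ x - num ν y * den μ x)
          ≈⟨ (pointwise λ n → solve 2 (λ X Z → X :+ (Z :- Z) := X) refl (seq (num ψ x) n) (seq (num ν y * den μ x) n)) ⟩
        num ψ x ∎
      e₁ : (1ℝ - y) * den ψ x ≈ den ψ x - num ψ x
      e₁ = ≈-trans (pointwise λ n → solve 2 (λ y Y → (con 1ℚ :- y) :* Y := Y :- y :* Y) refl (seq y n) (seq (den ψ x) n))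
                   (+-cong ≈-refl (-‿cong y*Y))
      e₂ : (y - (- 1ℝ)) * den ψ x ≈ num ψ x - (- den ψ x)
      e₂ = ≈-trans (pointwise λ n → solve 2 (λ y Y → (y :- (:- con 1ℚ)) :* Y := y :* Y :- (:- Y)) refl (seq y n) (seq (den ψ x) n))
                   (+-cong y*Y ≈-refl)

  neg : 𝕄 → 𝕄
  neg (mat a b c d) = mat (ℚ.- a) (ℚ.- b) (ℚ.- c) (ℚ.- d)

  included-neg : ∀ {μ μ′} ν → (∀ x → num μ′ x ≈ - num μ x) → (∀ x → den μ′ x ≈ - den μ x) →
                 Included μ ν → Included μ′ ν
  included-neg {μ} {μ′} ν num≈ den≈ (bdd , incl) =
    (λ x x∈ → #-respˡ-≈ (≈-sym (den≈ x)) (neg-# (bdd x x∈))) ,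
    λ s (x , x∈ , nz , s≈) →
      let (y , y∈ , nz′ , e) = incl _ (x , x∈ , bdd x x∈ , ≈-refl)
      in y , y∈ , nz′ , ≈-trans s≈ (≈-trans (cross-/ nz (bdd x x∈) (cross x)) e)
    where
    cross : ∀ x → num μ′ x * den μ x ≈ num μ x * den μ′ x
    cross x = begin
      num μ′ x * den μ x       ≈⟨ *-cong (num≈ x) ≈-refl ⟩
      (- num μ x) * den μ x    ≈⟨ (pointwise λ n → solve 2 (λ P Q → (:- P) :* Q := P :* (:- Q)) refl (seq (num μ x) n) (seq (den μ x) n)) ⟩
      num μ x * (- den μ x)    ≈⟨ *-cong ≈-refl (den≈ x) ⟨
      num μ x * den μ′ x       ∎

  to-neg : ∀ μ ν → Included μ ν → Included (neg μ) ν
  to-neg μ@(mat a b c d) ν = included-neg {μ} {neg μ} ν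
    (λ x → pointwise λ n → solve 3 (λ u v x → (:- u) :* x :+ (:- v) := :- (u :* x :+ v)) refl a b (seq x n))
    (λ x → pointwise λ n → solve 3 (λ u v x → (:- u) :* x :+ (:- v) := :- (u :* x :+ v)) refl c d (seq x n))

  from-neg : ∀ μ ν → Included (neg μ) ν → Included μ ν
  from-neg μ@(mat a b c d) ν = included-neg {neg μ} {μ} ν
    (λ x → pointwise λ n → solve 3 (λ u v x → u :* x :+ v := :- ((:- u) :* x :+ (:- v))) refl a b (seq x n))
    (λ x → pointwise λ n → solve 3 (λ u v x → u :* x :+ v := :- ((:- u) :* x :+ (:- v))) refl c d (seq x n))

  -- A bounded map whose denominator is positive at 1 is also positive at
  -- -1; otherwise the denominator vanishes at -d/c ∈ [-1,1].
  module Root (c d : ℚ) (0<c : 0ℚ ℚ.< c) (p : 0ℚ ℚ.≤ c ℚ.+ d) (q : 0ℚ ℚ.≤ c ℚ.- d) where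
    r : ℚ
    r = (ℚ.- d) ℚ.* recip c
    c*recip : c ℚ.* recip c ≡ 1ℚ
    c*recip = *-recip (λ e → ℚ.<⇒≢ 0<c (sym e))
    -1≤r : ℚ.- 1ℚ ℚ.≤ r
    -1≤r = ≤-by₁ (*-nonNeg q (ℚ.<⇒≤ (recip-pos 0<c)))
      (trans (cong (λ z → ℚ.- z ℚ.+ (c ℚ.- d) ℚ.* recip c) (sym c*recip))
        (solve 3 (λ c d s → (:- (c :* s)) :+ (c :- d) :* s := (:- d) :* s :+ con 0ℚ) refl c d (recip c)))
    r≤1 : r ℚ.≤ 1ℚ
    r≤1 = ≤-by₁ (*-nonNeg p (ℚ.<⇒≤ (recip-pos 0<c)))
      (trans (solve 3 (λ c d s → (:- d) :* s :+ (c :+ d) :* s := c :* s :+ con 0ℚ) refl c d (recip c))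
             (cong (ℚ._+ 0ℚ) c*recip))
    vanishes : c ℚ.* r ℚ.+ d ≡ 0ℚ
    vanishes = trans (solve 3 (λ c d s → c :* ((:- d) :* s) :+ d := d :* (con 1ℚ :- c :* s)) refl c d (recip c))
      (trans (cong (λ z → d ℚ.* (1ℚ ℚ.- z)) c*recip) (ℚ.*-zeroʳ d))

  #-irrefl : ∀ {x y} → x ≈ y → ¬ x # y
  #-irrefl e (inj₁ lt) = <-irrefl (<-respˡ-≈ e lt)
  #-irrefl e (inj₂ lt) = <-irrefl (<-respʳ-≈ e lt)

  pos-at--1 : ∀ μ → Bounded μ → 0ℚ ℚ.< 𝕄.c μ ℚ.* 1ℚ ℚ.+ 𝕄.d μ →
              0ℚ ℚ.< 𝕄.c μ ℚ.* (ℚ.- 1ℚ) ℚ.+ 𝕄.d μ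
  pos-at--1 μ@(mat _ _ c d) bdd p = [ (λ q → contradiction (ι-cancel-< (<-respˡ-≈ at--1 q)) not-neg)
                                    , (λ q → ι-cancel-< (<-respʳ-≈ at--1 q)) ]′ (bdd (ι (ℚ.- 1ℚ)) -1∈)
    where
    at--1 : den μ (ι (ℚ.- 1ℚ)) ≈ ι (c ℚ.* (ℚ.- 1ℚ) ℚ.+ d)
    at--1 = pointwise λ _ → refl
    not-neg : ¬ c ℚ.* (ℚ.- 1ℚ) ℚ.+ d ℚ.< 0ℚ
    not-neg q = #-irrefl {den μ (ι r)} (≈-trans (pointwise λ _ → refl) (ι-cong vanishes)) (bdd (ι r) (ι-∈ -1≤r r≤1))
      where
      0<c : 0ℚ ℚ.< c
      0<c = ℚ.*-cancelˡ-<-nonNeg (1ℚ ℚ.+ 1ℚ) (<-by₁ (ℚ.<-trans q p)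
        (solve 2 (λ c d → (con 1ℚ :+ con 1ℚ) :* con 0ℚ :+ (c :* con 1ℚ :+ d)
                       := (con 1ℚ :+ con 1ℚ) :* c :+ (c :* (:- con 1ℚ) :+ d)) refl c d))
      0≤c+d : 0ℚ ℚ.≤ c ℚ.+ d
      0≤c+d = ℚ.<⇒≤ (<-by₁ p (solve 2 (λ c d →
        con 0ℚ :+ (c :* con 1ℚ :+ d) := (c :+ d) :+ con 0ℚ) refl c d))
      0≤c-d : 0ℚ ℚ.≤ c ℚ.- d
      0≤c-d = ℚ.<⇒≤ (<-by₁ q (solve 2 (λ c d →
        con 0ℚ :+ con 0ℚ := (c :- d) :+ (c :* (:- con 1ℚ) :+ d)) refl c d))
      open Root c d 0<c 0≤c+d 0≤c-d

  complete : ∀ μ ν → Proper ν → Included μ ν → 0ℚ ℚ.< 𝕄.c μ ℚ.* 1ℚ ℚ.+ 𝕄.d μ → Criterion μ ν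
  complete μ ν pr (bdd , incl) p =
    endpoint-complete μ ν pr incl 1ℚ 1∈ p ,
    endpoint-complete μ ν pr incl (ℚ.- 1ℚ) -1∈ (pos-at--1 μ bdd p)

  included? : ∀ μ ν → Proper ν → Dec (Included μ ν)
  included? μ@(mat _ _ c d) ν pr with criterion? μ ν | criterion? (neg μ) ν
  ... | yes crit | _        = yes (sound μ ν pr crit)
  ... | no  _    | yes crit = yes (from-neg μ ν (sound (neg μ) ν pr crit))
  ... | no ¬crit | no ¬neg  = no λ incl → [ (λ q → ¬neg (complete (neg μ) ν pr (to-neg μ ν incl) (flip-sign q)))
                                          , (λ p → ¬crit (complete μ ν pr incl (ι-cancel-< (<-respʳ-≈ (pointwise λ _ → refl) p)))) ]′
                                          (proj₁ incl (ι 1ℚ) 1∈)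
    where
    flip-sign : den μ (ι 1ℚ) < 0ℝ → 0ℚ ℚ.< (ℚ.- c) ℚ.* 1ℚ ℚ.+ (ℚ.- d)
    flip-sign q = <-by₁ (ι-cancel-< {c ℚ.* 1ℚ ℚ.+ d} (<-respˡ-≈ (pointwise λ _ → refl) q))
      (solve 2 (λ c d → con 0ℚ :+ con 0ℚ := ((:- c) :* con 1ℚ :+ (:- d)) :+ (c :* con 1ℚ :+ d)) refl c d)

opaque
  Incl? : ∀ μ φ → Dec (Incl μ φ)
  Incl? μ φ = Incl-Decidable.included? μ ⟦ φ ⟧ (Incl-Decidable.digit-proper φ)

data Eₕ (μ : 𝕄) (α : DIGω) : Set where
  emit-L : Incl μ L → Eₕ μ α
  emit-R : Incl μ R → Eₕ μ α
  emit-M : Incl μ M → Eₕ μ α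
  absorb : Eₕ (μ ∘ ⟦ hd α ⟧) (tl α) → Eₕ μ α

m̄ₕ : ∀ μ α → Eₕ μ α → DIG × 𝕄 × DIGω
m̄ₕ μ α t with Incl? μ L
... | yes _ = L , ⟦ L ⟧⁻¹ ∘ μ , α
... | no ¬L with Incl? μ R
...   | yes _ = R , ⟦ R ⟧⁻¹ ∘ μ , α
...   | no ¬R with Incl? μ M
...     | yes _ = M , ⟦ M ⟧⁻¹ ∘ μ , α
...     | no ¬M with t
...       | emit-L i  = contradiction i ¬L
...       | emit-R i  = contradiction i ¬R
...       | emit-M i  = contradiction i ¬M
...       | absorb t′ = m̄ₕ (μ ∘ ⟦ hd α ⟧) (tl α) t′

π₁ : DIG × 𝕄 × DIGω → DIG
π₁ (φ , _ , _) = φ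

π₂ : DIG × 𝕄 × DIGω → 𝕄
π₂ (_ , μ , _) = μ

π₃ : DIG × 𝕄 × DIGω → DIGω
π₃ (_ , _ , α) = α

data Ψₕ : ℕ → 𝕄 → DIGω → Set where
  Ψ-zero : ∀ {μ α} → Eₕ μ α → Ψₕ 0 μ α
  Ψ-suc  : ∀ {n μ α} (t : Eₕ μ α) →
           Ψₕ n (π₂ (m̄ₕ μ α t)) (π₃ (m̄ₕ μ α t)) → Ψₕ (suc n) μ α

Pₕ : 𝕄 → DIGω → Set
Pₕ μ α = ∀ n → Ψₕ (suc n) μ α

m̄ₕ-irrelevant : ∀ μ α (t u : Eₕ μ α) → m̄ₕ μ α t ≡ m̄ₕ μ α u
m̄ₕ-irrelevant μ α t u with Incl? μ L
... | yes _ = refl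
... | no ¬L with Incl? μ R
...   | yes _ = refl
...   | no ¬R with Incl? μ M
...     | yes _ = refl
...     | no ¬M with t | u
...       | emit-L i  | _         = contradiction i ¬L
...       | emit-R i  | _         = contradiction i ¬R
...       | emit-M i  | _         = contradiction i ¬M
...       | absorb _  | emit-L i  = contradiction i ¬L
...       | absorb _  | emit-R i  = contradiction i ¬R
...       | absorb _  | emit-M i  = contradiction i ¬M
...       | absorb t′ | absorb u′ = m̄ₕ-irrelevant (μ ∘ ⟦ hd α ⟧) (tl α) t′ u′

P⇒E : ∀ {μ α} → Pₕ μ α → Eₕ μ α
P⇒E p with p 0
... | Ψ-suc t _ = t

P⇒P : ∀ {μ α} → Pₕ μ α → (t : Eₕ μ α) → Pₕ (π₂ (m̄ₕ μ α t)) (π₃ (m̄ₕ μ α t))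
P⇒P {μ} {α} p t n with p (suc n)
... | Ψ-suc u ψ = subst (λ z → Ψₕ (suc n) (π₂ z) (π₃ z)) (m̄ₕ-irrelevant μ α u t) ψ

-- The corecursive equation h̄ μ α p = Cons φ (h̄ μ′ α′ p′), entry by entry.
h̄ : ∀ μ α → Pₕ μ α → DIGω
h̄ μ α p zero    = π₁ (m̄ₕ μ α (P⇒E p))
h̄ μ α p (suc n) = h̄ (π₂ (m̄ₕ μ α (P⇒E p))) (π₃ (m̄ₕ μ α (P⇒E p))) (P⇒P p (P⇒E p)) n

opaque
  r+3#0 : ∀ {r} → - 1ℝ ≤ r → (r + 3ℝ) # 0ℝ
  r+3#0 {r} -1≤r = inj₂ (<-≤-trans (ι-mono-< 0<1) (0≤-⇒≤ (≤-respʳ-≈ e (≤-respˡ-≈ (pointwise λ _ → refl)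
    (+-mono-≤ (≤⇒0≤- -1≤r) (ι-mono-≤ (ℚ.<⇒≤ 0<1)))))))
    where
    open +-*-Solver
    e : (r - (- 1ℝ)) + 1ℝ ≈ (r + 3ℝ) - 1ℝ
    e = pointwise λ n → solve 1 (λ r → (r :- (:- con 1ℚ)) :+ con 1ℚ := (r :+ con (+ 3 ℚ./ 1)) :- con 1ℚ) refl (seq r n)

  -r+3#0 : ∀ {r} → r ≤ 1ℝ → (- r + 3ℝ) # 0ℝ
  -r+3#0 {r} r≤1 = inj₂ (<-≤-trans (ι-mono-< 0<1) (0≤-⇒≤ (≤-respʳ-≈ e (≤-respˡ-≈ (pointwise λ _ → refl)
    (+-mono-≤ (≤⇒0≤- r≤1) (ι-mono-≤ (ℚ.<⇒≤ 0<1)))))))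
    where
    open +-*-Solver
    e : (1ℝ - r) + 1ℝ ≈ (- r + 3ℝ) - 1ℝ
    e = pointwise λ n → solve 1 (λ r → (con 1ℚ :- r) :+ con 1ℚ := ((:- r) :+ con (+ 3 ℚ./ 1)) :- con 1ℚ) refl (seq r n)

  3#0 : 3ℝ # 0ℝ
  3#0 = inj₂ (ι-mono-< (toWitness {a? = 0ℚ ℚ.<? + 3 ℚ./ 1} _))

-- Step X β s: the pair (β , s) is, up to _≅_ and _≈_, the conclusion of a
-- rule whose premise lies in X.
data Step {ℓ} (X : DIGω → ℝ → Set ℓ) (β : DIGω) (s : ℝ) : Set ℓ where
  step-L : ∀ {α r} (-1≤r : - 1ℝ ≤ r) (r≤1 : r ≤ 1ℝ) → X α r →
           β ≅ Cons L α → s ≈ (r - 1ℝ) / (r + 3ℝ) [ r+3#0 -1≤r ] → Step X β s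
  step-R : ∀ {α r} (-1≤r : - 1ℝ ≤ r) (r≤1 : r ≤ 1ℝ) → X α r →
           β ≅ Cons R α → s ≈ (r + 1ℝ) / (- r + 3ℝ) [ -r+3#0 r≤1 ] → Step X β s
  step-M : ∀ {α r} (-1≤r : - 1ℝ ≤ r) (r≤1 : r ≤ 1ℝ) → X α r →
           β ≅ Cons M α → s ≈ r / 3ℝ [ 3#0 ] → Step X β s

-- The greatest fixed point of Step, as the union of all its post-fixed
-- points (relations X with X ⊆ Step X).
rep : DIGω → ℝ → Set₁
rep α r = Σ[ X ∈ (DIGω → ℝ → Set) ] (∀ {β s} → X β s → Step X β s) × X α r

rep-out : ∀ {α r} → rep α r → Step rep α r
rep-out (X , post , x) with post x
... | step-L l u x′ e s≈ = step-L l u (X , post , x′) e s≈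
... | step-R l u x′ e s≈ = step-R l u (X , post , x′) e s≈
... | step-M l u x′ e s≈ = step-M l u (X , post , x′) e s≈

-- Every post-fixed point, of whatever universe level, is contained in rep:
-- the pairs met while unfolding a given one form a small post-fixed point.
rep-coind : ∀ {ℓ} (X : DIGω → ℝ → Set ℓ) → (∀ {β s} → X β s → Step X β s) →
            ∀ {α r} → X α r → rep α r
rep-coind X post {α} {r} x = Orbit , orbit-post , 0 , refl , refl
  where
  State : Set _
  State = ∃[ β ] ∃[ s ] X β s
  next : ∀ {β s} → Step X β s → State
  next (step-L {β′} {s′} _ _ x′ _ _) = β′ , s′ , x′
  next (step-R {β′} {s′} _ _ x′ _ _) = β′ , s′ , x′
  next (step-M {β′} {s′} _ _ x′ _ _) = β′ , s′ , x′
  state : ℕ → State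
  state zero    = α , r , x
  state (suc n) = next (post (proj₂ (proj₂ (state n))))
  Orbit : DIGω → ℝ → Set
  Orbit β s = ∃[ n ] β ≡ proj₁ (state n) × s ≡ proj₁ (proj₂ (state n))
  advance : ∀ {β s} (st : Step X β s) → ∀ n → next st ≡ state n → Step Orbit β s
  advance (step-L l u _ e s≈) n refl = step-L l u (n , refl , refl) e s≈
  advance (step-R l u _ e s≈) n refl = step-R l u (n , refl , refl) e s≈
  advance (step-M l u _ e s≈) n refl = step-M l u (n , refl , refl) e s≈
  orbit-post : ∀ {β s} → Orbit β s → Step Orbit β s
  orbit-post (n , refl , refl) = advance (post (proj₂ (proj₂ (state n)))) (suc n) refl

{-# OPTIONS --safe #-}

-- Möbius maps compose at a point, as far as the denominators are apart from
-- zero.  If α represents r, absorbing a digit φ replaces r by a preimage r′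
-- under φ and μ by μ ∘ φ, so the value μ(r) is unchanged; emitting φ replaces
-- that value by the point of [-1,1] which φ sends to it.  Hence the pairs
-- (h̄ μ α p , μ(r)) form a post-fixed point of Step.

module Submission where

open import Defs
open import Algebra.Bundles using (CommutativeRing)
open import Data.Integer.Base using (+_)
open import Data.Nat.Base using (zero; suc)
open import Data.Product.Base using (Σ-syntax; ∃-syntax; _×_; _,_; proj₁; proj₂)
open import Data.Rational.Base as ℚ using (0ℚ; 1ℚ; ½; -½)
open import Data.Rational.Solver using (module +-*-Solver)
open import Data.Sum.Base using (inj₁; inj₂)
open import Relation.Binary.PropositionalEquality using (_≡_; refl; sym; trans; subst)
open import Relation.Nullary.Decidable using (yes; no; toWitness)
open import Relation.Nullary.Negation using (contradiction)

open ℚ-Arithmetic using (0<1)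
open Incl-Decidable
  using (linear-pos; digit-proper; Proper; proper?; Criterion; criterion?; sound)
open +-*-Solver using (solve; _:=_; _:+_; _:*_; _:-_; :-_; con)
open CommutativeRing ℝ-commutativeRing
  using (+-identityˡ; -‿inverseʳ; *-comm; *-assoc; *-identityʳ)

-‿pos : ∀ {x} → x < 0ℝ → 0ℝ < - x
-‿pos {x} x<0 = <-respˡ-≈ (-‿inverseʳ x)
  (<-respʳ-≈ (+-identityˡ (- x)) (+-mono-<-≤ x<0 (≈⇒≤ (≈-refl { - x }))))

-‿involutive : ∀ x → - (- x) ≈ x
-‿involutive x = pointwise λ n → solve 1 (λ x → :- (:- x) := x) refl (seq x n)

-- Apartness is a disjunction of strict inequalities, so the sign of the product settles which one
-- holds for `x`; a negative product is turned positive by passing to `- x`.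
#0-cancelʳ⁺ : ∀ {x y} → 0ℝ < y → (x * y) # 0ℝ → x # 0ℝ
#0-cancelʳ⁺ 0<y (inj₂ 0<xy) = inj₂ (0<-cancelʳ 0<y 0<xy)
#0-cancelʳ⁺ {x} {y} 0<y (inj₁ xy<0) = #-respˡ-≈ (-‿involutive x)
  (neg-# (inj₂ (0<-cancelʳ 0<y (<-respʳ-≈ (pointwise λ n →
    solve 2 (λ x y → :- (x :* y) := (:- x) :* y) refl (seq x n) (seq y n)) (-‿pos xy<0)))))

#0-cancelʳ : ∀ {x y} → y # 0ℝ → (x * y) # 0ℝ → x # 0ℝ
#0-cancelʳ (inj₂ 0<y) xy#0 = #0-cancelʳ⁺ 0<y xy#0
#0-cancelʳ {x} {y} (inj₁ y<0) xy#0 = #0-cancelʳ⁺ (-‿pos y<0)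
  (#-respˡ-≈ (pointwise λ n → solve 2 (λ x y → :- (x :* y) := x :* (:- y)) refl (seq x n) (seq y n)) (neg-# xy#0))

inv-#0 : ∀ x x#0 → inv x x#0 # 0ℝ
inv-#0 x x#0 = #0-cancelʳ x#0 (#-respˡ-≈
  (≈-trans (≈-sym (*-inverseʳ x x#0)) (*-comm x (inv x x#0))) (inj₂ (ι-mono-< 0<1)))

-- No case split on signs: `x ≈ (x * y) * inv y y#0`, and the factor `inv y y#0` cancels.
*-#0 : ∀ {x y} → x # 0ℝ → y # 0ℝ → (x * y) # 0ℝ
*-#0 {x} {y} x#0 y#0 = #0-cancelʳ (inv-#0 y y#0) (#-respˡ-≈ (≈-sym
  (≈-trans (*-assoc x y (inv y y#0)) (≈-trans (*-cong ≈-refl (*-inverseʳ y y#0)) (*-identityʳ x)))) x#0)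

-- `(u v)` is a row of the outer matrix, so one computation serves both numerator and denominator of
-- a composite. The hypothesis is `s = ν(x)` with the division cleared.
linear-∘ : ∀ u v ν {x s} → s * den ν x ≈ num ν x →
           (ι u * s + ι v) * den ν x ≈
           ι (u ℚ.* 𝕄.a ν ℚ.+ v ℚ.* 𝕄.c ν) * x + ι (u ℚ.* 𝕄.b ν ℚ.+ v ℚ.* 𝕄.d ν)
linear-∘ u v ν@(mat a b c d) {x} {s} e = begin
  (ι u * s + ι v) * den ν x
    ≈⟨ (pointwise λ n → solve 4 (λ u v s Q → (u :* s :+ v) :* Q := u :* (s :* Q) :+ v :* Q)
          refl u v (seq s n) (seq (den ν x) n)) ⟩
  ι u * (s * den ν x) + ι v * den ν x
    ≈⟨ +-cong (*-cong ≈-refl e) ≈-refl ⟩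
  ι u * num ν x + ι v * den ν x
    ≈⟨ (pointwise λ n → solve 7 (λ u v a b c d x →
          u :* (a :* x :+ b) :+ v :* (c :* x :+ d)
          := (u :* a :+ v :* c) :* x :+ (u :* b :+ v :* d)) refl u v a b c d (seq x n)) ⟩
  ι (u ℚ.* a ℚ.+ v ℚ.* c) * x + ι (u ℚ.* b ℚ.+ v ℚ.* d) ∎
  where open ≈-Reasoning

≈/⇒*≈ : ∀ {s x y} y#0 → s ≈ x / y [ y#0 ] → s * y ≈ x
≈/⇒*≈ {x = x} y#0 e = ≈-trans (*-cong e ≈-refl) (/-* x y#0)

module _ (μ ν : 𝕄) {x s : ℝ} (nz : den ν x # 0ℝ) (e : s ≈ apply ν x nz) where
  private
    den-∘ : den μ s * den ν x ≈ den (μ ∘ ν) x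
    den-∘ = linear-∘ (𝕄.c μ) (𝕄.d μ) ν (≈/⇒*≈ nz e)

    num-∘ : num μ s * den ν x ≈ num (μ ∘ ν) x
    num-∘ = linear-∘ (𝕄.a μ) (𝕄.b μ) ν (≈/⇒*≈ nz e)

  den-∘⁻ : den (μ ∘ ν) x # 0ℝ → den μ s # 0ℝ
  den-∘⁻ nz′ = #0-cancelʳ nz (#-respˡ-≈ (≈-sym den-∘) nz′)

  den-∘⁺ : den μ s # 0ℝ → den (μ ∘ ν) x # 0ℝ
  den-∘⁺ nz′ = #-respˡ-≈ den-∘ (*-#0 nz′ nz)

  apply-∘ : ∀ nz₁ nz₂ → apply μ s nz₁ ≈ apply (μ ∘ ν) x nz₂
  -- Numerator and denominator of `μ` at `s` both lack the same factor `den ν x`, so it cancels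
  -- across the fraction.
  apply-∘ nz₁ nz₂ = cross-/ nz₁ nz₂ (begin
    num μ s * den (μ ∘ ν) x         ≈⟨ *-cong ≈-refl den-∘ ⟨
    num μ s * (den μ s * den ν x)
      ≈⟨ (pointwise λ n → solve 3 (λ p q r → p :* (q :* r) := (p :* r) :* q)
            refl (seq (num μ s) n) (seq (den μ s) n) (seq (den ν x) n)) ⟩
    num μ s * den ν x * den μ s     ≈⟨ *-cong num-∘ ≈-refl ⟩
    num (μ ∘ ν) x * den μ s         ∎)
    where open ≈-Reasoning

identity : 𝕄
identity = mat 1ℚ 0ℚ 0ℚ 1ℚ

⟦⟧-inverseˡ : ∀ φ → ⟦ φ ⟧⁻¹ ∘ ⟦ φ ⟧ ≡ identity
⟦⟧-inverseˡ L = refl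
⟦⟧-inverseˡ R = refl
⟦⟧-inverseˡ M = refl

-- Stated for a matrix merely equal to `identity`, because `⟦ φ ⟧⁻¹ ∘ ⟦ φ ⟧` does not reduce while
-- `φ` is a variable.
den-identity : ∀ {ι′} → ι′ ≡ identity → ∀ x → den ι′ x # 0ℝ
den-identity refl x = #-respˡ-≈ (pointwise λ n →
  solve 1 (λ x → con 1ℚ := con 0ℚ :* x :+ con 1ℚ) refl (seq x n)) (inj₂ (ι-mono-< 0<1))

apply-identity : ∀ {ι′} → ι′ ≡ identity → ∀ x nz → apply ι′ x nz ≈ x
apply-identity refl x nz = *-cancelʳ nz (≈-trans (/-* (num identity x) nz) (pointwise λ n →
  solve 1 (λ x → con 1ℚ :* x :+ con 0ℚ := x :* (con 0ℚ :* x :+ con 1ℚ)) refl (seq x n)))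

den-digit : ∀ φ {x} → x ∈[-1,1] → den ⟦ φ ⟧ x # 0ℝ
den-digit φ x∈ = let (_ , p , q) = digit-proper φ in inj₂ (linear-pos x∈ p q)

module _ (μ : 𝕄) (φ : DIG) {r : ℝ} (r∈ : r ∈[-1,1]) (incl : Incl μ φ) where
  -- The inclusion yields `y` in [-1,1] with μ(r) = φ(y); applying the inverse of φ identifies `y`
  -- with the value of `⟦ φ ⟧⁻¹ ∘ μ` at `r`.
  emit : (nz : den μ r # 0ℝ) → Σ[ nz′ ∈ den (⟦ φ ⟧⁻¹ ∘ μ) r # 0ℝ ]
         let y = apply (⟦ φ ⟧⁻¹ ∘ μ) r nz′ in
         y ∈[-1,1] × Σ[ nzφ ∈ den ⟦ φ ⟧ y # 0ℝ ] apply μ r nz ≈ apply ⟦ φ ⟧ y nzφ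
  emit nz =
    let (y , (-1≤y , y≤1) , nzy , e) = proj₂ incl _ (r , r∈ , nz , ≈-refl)
        nzI   = den-identity (⟦⟧-inverseˡ φ) y
        -- The inverse digit is defined at μ(r) = φ(y), since its composite with φ has denominator 1
        -- at `y`.
        nz⁻¹  = den-∘⁻ ⟦ φ ⟧⁻¹ ⟦ φ ⟧ nzy e nzI
        nz′   = den-∘⁺ ⟦ φ ⟧⁻¹ μ nz ≈-refl nz⁻¹
        y≈    = ≈-trans (≈-sym (apply-identity (⟦⟧-inverseˡ φ) y nzI))
                (≈-trans (≈-sym (apply-∘ ⟦ φ ⟧⁻¹ ⟦ φ ⟧ nzy e nz⁻¹ nzI))
                         (apply-∘ ⟦ φ ⟧⁻¹ μ nz ≈-refl nz⁻¹ nz′))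
        y′∈   = ≤-respʳ-≈ y≈ -1≤y , ≤-respˡ-≈ y≈ y≤1
        nzφ   = den-digit φ y′∈
    in nz′ , y′∈ , nzφ , ≈-trans e (cross-/ nzy nzφ
         (*-cong (+-cong (*-cong ≈-refl y≈) ≈-refl)
                 (+-cong (*-cong ≈-refl (≈-sym y≈)) ≈-refl)))

-- The image of `identity` is [-1,1], so this criterion makes each digit a self-map of [-1,1]; it
-- consists of rational inequalities at the endpoints, decided by evaluation.
digit-criterion : ∀ φ → Criterion ⟦ φ ⟧ identity
digit-criterion L = toWitness {a? = criterion? ⟦ L ⟧ identity} _
digit-criterion R = toWitness {a? = criterion? ⟦ R ⟧ identity} _
digit-criterion M = toWitness {a? = criterion? ⟦ M ⟧ identity} _

identity-proper : Proper identity
identity-proper = toWitness {a? = proper? identity} _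

digit-∈ : ∀ φ {x s} → x ∈[-1,1] → (nz : den ⟦ φ ⟧ x # 0ℝ) → s ≈ apply ⟦ φ ⟧ x nz → s ∈[-1,1]
digit-∈ φ {x} {s} x∈ nz e =
  let (y , (-1≤y , y≤1) , nzy , s≈) =
        proj₂ (sound ⟦ φ ⟧ identity identity-proper (digit-criterion φ)) s (x , x∈ , nz , e)
      y≈s = ≈-sym (≈-trans s≈ (apply-identity refl y nzy))
  in ≤-respʳ-≈ y≈s -1≤y , ≤-respˡ-≈ y≈s y≤1

-- The entries of the matrix are half the coefficients of the rule; cross-multiplication absorbs the
-- factor.
L-formula : ∀ {x} nz nz′ → apply ⟦ L ⟧ x nz ≈ (x - 1ℝ) / (x + 3ℝ) [ nz′ ]
L-formula {x} nz nz′ = cross-/ nz nz′ (pointwise λ n → solve 1 (λ x →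
  (con ½ :* x :+ con -½) :* (x :+ con (+ 3 ℚ./ 1))
  := (x :- con 1ℚ) :* (con ½ :* x :+ con (+ 3 ℚ./ 2))) refl (seq x n))

R-formula : ∀ {x} nz nz′ → apply ⟦ R ⟧ x nz ≈ (x + 1ℝ) / (- x + 3ℝ) [ nz′ ]
R-formula {x} nz nz′ = cross-/ nz nz′ (pointwise λ n → solve 1 (λ x →
  (con ½ :* x :+ con ½) :* ((:- x) :+ con (+ 3 ℚ./ 1))
  := (x :+ con 1ℚ) :* (con -½ :* x :+ con (+ 3 ℚ./ 2))) refl (seq x n))

M-formula : ∀ {x} nz nz′ → apply ⟦ M ⟧ x nz ≈ x / 3ℝ [ nz′ ]
M-formula {x} nz nz′ = cross-/ nz nz′ (pointwise λ n → solve 1 (λ x →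
  (con 1ℚ :* x :+ con 0ℚ) :* con (+ 3 ℚ./ 1)
  := x :* (con 0ℚ :* x :+ con (+ 3 ℚ./ 1))) refl (seq x n))

step : ∀ {ℓ} {X : DIGω → ℝ → Set ℓ} φ {α β r s} → r ∈[-1,1] → X α r → β ≅ Cons φ α →
       (nz : den ⟦ φ ⟧ r # 0ℝ) → s ≈ apply ⟦ φ ⟧ r nz → Step X β s
step L (-1≤r , r≤1) x β≅ nz e = step-L -1≤r r≤1 x β≅ (≈-trans e (L-formula nz _))
step R (-1≤r , r≤1) x β≅ nz e = step-R -1≤r r≤1 x β≅ (≈-trans e (R-formula nz _))
step M (-1≤r , r≤1) x β≅ nz e = step-M -1≤r r≤1 x β≅ (≈-trans e (M-formula nz _))

step⁻¹ : ∀ {ℓ} {X : DIGω → ℝ → Set ℓ} {β s} → Step X β s →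
         ∃[ φ ] ∃[ α ] ∃[ r ] r ∈[-1,1] × X α r × β ≅ Cons φ α ×
         Σ[ nz ∈ den ⟦ φ ⟧ r # 0ℝ ] s ≈ apply ⟦ φ ⟧ r nz
step⁻¹ (step-L -1≤r r≤1 x β≅ e) = let nz = den-digit L (-1≤r , r≤1) in
  L , _ , _ , (-1≤r , r≤1) , x , β≅ , nz , ≈-trans e (≈-sym (L-formula nz _))
step⁻¹ (step-R -1≤r r≤1 x β≅ e) = let nz = den-digit R (-1≤r , r≤1) in
  R , _ , _ , (-1≤r , r≤1) , x , β≅ , nz , ≈-trans e (≈-sym (R-formula nz _))
step⁻¹ (step-M -1≤r r≤1 x β≅ e) = let nz = den-digit M (-1≤r , r≤1) in
  M , _ , _ , (-1≤r , r≤1) , x , β≅ , nz , ≈-trans e (≈-sym (M-formula nz _))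

-- A single unfolding suffices: `r` is a digit applied to a point of [-1,1].
rep-∈ : ∀ {α r} → rep α r → r ∈[-1,1]
rep-∈ α∼r with step⁻¹ (rep-out α∼r)
... | φ , _ , _ , r∈ , _ , _ , nz , e = digit-∈ φ r∈ nz e

-- Each rule determines its stream only up to `_≅_`, so the first unfolding absorbs the bisimilarity
-- and the tails then coincide.
rep-resp-≅ : ∀ {α β r} → α ≅ β → rep α r → rep β r
rep-resp-≅ α≅β α∼r = rep-coind X post (_ , α≅β , α∼r)
  where
  X : DIGω → ℝ → Set₁
  X β r = ∃[ α ] α ≅ β × rep α r
  post : ∀ {β r} → X β r → Step X β r
  post (_ , α≅β , α∼r) with step⁻¹ (rep-out α∼r)
  ... | φ , α′ , _ , r∈ , α′∼r , α≅ , nz , e =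
    step φ r∈ (α′ , (λ _ → refl) , α′∼r) (λ n → trans (sym (α≅β n)) (α≅ n)) nz e

rep-tl : ∀ {α r} → rep α r → ∃[ r′ ] rep (tl α) r′ ×
         Σ[ nz ∈ den ⟦ hd α ⟧ r′ # 0ℝ ] r ≈ apply ⟦ hd α ⟧ r′ nz
rep-tl α∼r with step⁻¹ (rep-out α∼r)
... | φ , α′ , r′ , _ , α′∼r′ , α≅ , nz , e =
  r′ , rep-resp-≅ (λ n → sym (α≅ (suc n))) α′∼r′ ,
  subst (λ φ → Σ[ nz ∈ den ⟦ φ ⟧ r′ # 0ℝ ] _ ≈ apply ⟦ φ ⟧ r′ nz) (sym (α≅ 0)) (nz , e)

-- For a triple (φ , μ′ , α′): μ(r) = φ(μ′(r′)) for some r′ represented by α′.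
Factors : 𝕄 → ℝ → DIG × 𝕄 × DIGω → Set₁
Factors μ r (φ , μ′ , α′) =
  Σ[ nz ∈ den μ r # 0ℝ ] ∃[ r′ ] rep α′ r′ × Σ[ nz′ ∈ den μ′ r′ # 0ℝ ]
  let y = apply μ′ r′ nz′ in
  y ∈[-1,1] × Σ[ nzφ ∈ den ⟦ φ ⟧ y # 0ℝ ] apply μ r nz ≈ apply ⟦ φ ⟧ y nzφ

emit-factors : ∀ μ φ {α r} → rep α r → Incl μ φ → Factors μ r (φ , ⟦ φ ⟧⁻¹ ∘ μ , α)
emit-factors μ φ α∼r incl =
  let nz = proj₁ incl _ (rep-∈ α∼r)
  in nz , _ , α∼r , emit μ φ (rep-∈ α∼r) incl nz

-- Induction on `t`, with the case analysis of `m̄ₕ` repeated so that its result reduces in each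
-- branch.
m̄ₕ-factors : ∀ μ α {r} (t : Eₕ μ α) → rep α r → Factors μ r (m̄ₕ μ α t)
m̄ₕ-factors μ α t α∼r with Incl? μ L
... | yes i = emit-factors μ L α∼r i
... | no ¬L with Incl? μ R
...   | yes i = emit-factors μ R α∼r i
...   | no ¬R with Incl? μ M
...     | yes i = emit-factors μ M α∼r i
...     | no ¬M with t
...       | emit-L i  = contradiction i ¬L
...       | emit-R i  = contradiction i ¬R
...       | emit-M i  = contradiction i ¬M
...       | absorb t′ =
  let (_ , α′∼r′ , nzφ , r≈) = rep-tl α∼r
      (nz , r″ , α″∼r″ , nz″ , y∈ , nzψ , e) = m̄ₕ-factors (μ ∘ ⟦ hd α ⟧) (tl α) t′ α′∼r′
      -- Boundedness is known only at the final emission; nonvanishing is carried back through each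
      -- absorbed digit.
      nzμ = den-∘⁻ μ ⟦ hd α ⟧ nzφ r≈ nz
  in nzμ , r″ , α″∼r″ , nz″ , y∈ , nzψ ,
     ≈-trans (apply-∘ μ ⟦ hd α ⟧ nzφ r≈ nzμ nz) e

-- Lies in `Set₁` because `rep` does, which is why coinduction at an arbitrary level is used.
Image : DIGω → ℝ → Set₁
Image β s = ∃[ μ ] ∃[ α ] ∃[ r ] Σ[ p ∈ Pₕ μ α ] rep α r × β ≡ h̄ μ α p ×
            Σ[ nz ∈ den μ r # 0ℝ ] s ≈ apply μ r nz

Image-post : ∀ {β s} → Image β s → Step Image β s
Image-post (μ , α , r , p , α∼r , refl , nz , s≈) =
  let t = P⇒E p
      (nz₁ , r′ , α′∼r′ , nz′ , y∈ , nzφ , e) = m̄ₕ-factors μ α t α∼r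
  in step (π₁ (m̄ₕ μ α t)) y∈
       (_ , _ , r′ , P⇒P p t , α′∼r′ , refl , nz′ , ≈-refl)
       -- The corecursive equation of `h̄` holds by computation only once the index is split.
       (λ { zero → refl ; (suc _) → refl }) nzφ
       -- The value of `μ` at `r` does not depend on which proof, `nz` or `nz₁`, keeps the
       -- denominator apart from zero.
       (≈-trans s≈ (≈-trans (cross-/ nz nz₁ ≈-refl) e))

theorem5p5 : (μ : 𝕄) (α : DIGω) (r : ℝ) (p : Pₕ μ α) →
    rep α r → Σ[ nz ∈ den μ r # 0ℝ ] rep (h̄ μ α p) (apply μ r nz)
theorem5p5 μ α r p α∼r =
  -- That μ(r) is defined is itself a consequence of the first emission.
  let nz = proj₁ (m̄ₕ-factors μ α (P⇒E p) α∼r)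
  in nz , rep-coind Image Image-post (μ , α , r , p , α∼r , refl , nz , ≈-refl)
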